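{- For each update step $i\in[n]$, the Sliding Window Attention algorithm (described in the context) with window size $W>0$, run on a stream of triples $(q_i,k_i,v_i)\in(\mathbb{R}^d)^3$, produces an unbiased estimator $O_i\in\mathbb{R}^d$ of the sliding window attention function; that is, $$\mathbb{E}[O_{ij}]=\operatorname{Attn}_W(q_i,K_i,V_i)_j\quad\text{for all } j\in[d].$$ Furthermore, the algorithm uses $O(dW)$ space and $O(dW)$ time per update step.
   Context: The input is a stream of $n$ triples $(q_i,k_i,v_i)\in(\mathbb{R}^d)^3$. $K_i$ and $V_i$ are the $i\times d$ matrices whose rows are $k_1^T,\dots,k_i^T$ and $v_1^T,\dots,v_i^T$. Sliding window attention with unmasked values: let $S_i:=K_iq_i\in\mathbb{R}^i$, let $M\in\mathbb{R}^i$ be the mask $M_\ell=\mathbb{1}\{\ell>i-W\}$, and $h(S_i):=S_i\circ M$ (element-wise product). Then $\operatorname{Attn}_W(q_i,K_i,V_i):=\sigma(h(S_i))^TV_i\in\mathbb{R}^d$, where $\sigma$ is the softmax on $\mathbb{R}^i$; i.e. for $i>W$ the softmax is taken of the scores $(0,\dots,0,q_i^Tk_{i-W+1},\dots,q_i^Tk_i)$, and positions outside the window still contribute their value vectors with unnormalized weight $1$. Sliding Window Attention algorithm (window size $W$). Maintain lists $K,V$ of stored keys and values, initially empty. (1) For $i=1,\dots,W$: receive $(q_i,k_i,v_i)$; append $k_i$ to $K$ and $v_i$ to $V$; output $\operatorname{Attn}_W(q_i,K,V)$ by direct calculation. (2) Initialize $v_s\leftarrow\emptyset$ (a stored value vector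 from outside the window). (3) For $i=W+1,\dots,n$: receive $(q_i,k_i,v_i)$; pop the first (oldest) element of $V$, calling it $v$, and remove the first element of $K$; append $k_i$ to $K$ and $v_i$ to $V$; with probability $(i-W)^{ -1}$ replace $v_s\leftarrow v$ (reservoir sampling); let $S:=(i-W)+\sum_{k\in K}e^{q_i^Tk}$; with probability $(S-i+W)/S$ sample $\ell\in\{i-W+1,\dots,i\}$ with probability proportional to $e^{q_i^Tk_\ell}$ and output $v_\ell$; otherwise output $v_s$. $O_i$ denotes the output at step $i$ and $O_{ij}$ its $j$-th coordinate. Space is counted as the number of stored scalars (real coordinates). -}

module Defs where

open import Algebra.Apartness.Bundles using (HeytingField)
open import Algebra.Bundles using (CommutativeRing)
import Algebra.Properties.Semiring.Mult as Mult
import Algebra.Properties.Semiring.Sum as Sum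
open import Data.Bool.Base using (Bool; true; false; if_then_else_)
open import Data.Fin.Base using (Fin; zero; suc; toℕ; inject≤)
open import Data.Fin.Properties using (toℕ<n)
open import Data.Maybe.Base using (Maybe; just; nothing; fromMaybe; maybe′)
open import Data.Nat.Base as ℕ using (ℕ; zero; suc; NonZero; >-nonZero⁻¹)
open import Data.Nat.Properties using (m≤n⇒m<n∨m≡n; _<?_)
open import Data.Product.Base using (Σ; ∃; _×_; _,_; proj₁; proj₂)
open import Data.Sum.Base using (_⊎_; inj₁; inj₂)
open import Data.Vec.Base using (Vec; []; _∷_; _∷ʳ_; lookup; replicate)
open import Data.Vec.Functional using (Vector; foldr)
open import Level using (Level) renaming (suc to lsuc; _⊔_ to _⊔ₗ_)
open import Relation.Binary.Core using (Rel)
open import Relation.Binary.Definitions using (Transitive; Irreflexive)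
open import Relation.Binary.Lattice.Structures using (IsLattice)
open import Relation.Binary.PropositionalEquality.Core using (refl)
open import Relation.Nullary.Decidable.Core using (⌊_⌋)
open import Relation.Nullary.Negation.Core using (¬_)

-- The library has no real numbers, so ℝ is given by its axioms: an ordered
-- field that is Archimedean and Cauchy complete, with its exponential function.
-- Classically these determine ℝ and exp uniquely (a homomorphism from (ℝ, +) to
-- (ℝ⁺, ·) with 1 + x ≤ exp x is x ↦ eˣ).  Neither decidability of _<_ nor
-- totality of _≤_ is asked for, so that the constructive reals are a model too.
record RealNumbers (c ℓ₁ ℓ₂ : Level) : Set (lsuc (c ⊔ₗ ℓ₁ ⊔ₗ ℓ₂)) where
  infix 4 _<_ _≤_
  infixl 7 _⊓_
  infixl 6 _⊔_
  field
    heytingField : HeytingField c ℓ₁ ℓ₂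

  open HeytingField heytingField public renaming (Carrier to ℝ)

  commutativeRing : CommutativeRing c ℓ₁
  commutativeRing = record { isCommutativeRing = isCommutativeRing }

  open CommutativeRing commutativeRing public using (semiring)
  open Mult semiring public using () renaming (_×_ to _·_)
  open Sum semiring public using (sum)

  fromℕ : ℕ → ℝ
  fromℕ n = n · 1#

  field
    _<_      : Rel ℝ ℓ₂
    <-irrefl : Irreflexive _≈_ _<_
    <-trans  : Transitive _<_
    <-respˡ  : ∀ {x y z} → x ≈ y → x < z → y < z
    <-respʳ  : ∀ {x y z} → x ≈ y → z < x → z < y
    #⇒<∨>    : ∀ {x y} → x # y → x < y ⊎ y < x
    <⇒#      : ∀ {x y} → x < y → x # y
    0<1      : 0# < 1#
    +-mono-< : ∀ {x y} z → x < y → x + z < y + z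
    *-pos    : ∀ {x y} → 0# < x → 0# < y → 0# < x * y

  _≤_ : Rel ℝ ℓ₂
  x ≤ y = ¬ (y < x)

  CauchySequence : (ℕ → ℝ) → Set ℓ₂
  CauchySequence s = ∀ k → ∃ λ N → ∀ m n → N ℕ.≤ m → N ℕ.≤ n →
    (s m - s n) * fromℕ (suc k) < 1#

  _ConvergesTo_ : (ℕ → ℝ) → ℝ → Set ℓ₂
  s ConvergesTo x = ∀ k → ∃ λ N → ∀ n → N ℕ.≤ n →
    (s n - x) * fromℕ (suc k) < 1# × (x - s n) * fromℕ (suc k) < 1#

  field
    _⊔_ _⊓_     : ℝ → ℝ → ℝ
    isLattice   : IsLattice _≈_ _≤_ _⊔_ _⊓_
    archimedean : ∀ x → ∃ λ n → x < fromℕ n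
    complete    : ∀ s → CauchySequence s → ∃ λ x → s ConvergesTo x
    exp         : ℝ → ℝ
    exp-cong    : ∀ {x y} → x ≈ y → exp x ≈ exp y
    exp-+       : ∀ x y → exp (x + y) ≈ exp x * exp y
    0<exp       : ∀ x → 0# < exp x
    1+x≤exp     : ∀ x → 1# + x ≤ exp x

module SlidingWindow {c ℓ₁ ℓ₂} (R : RealNumbers c ℓ₁ ℓ₂) where
  open RealNumbers R hiding (refl; zero)

  -- Admissible divisors.
  ℝ⁺ : Set (c ⊔ₗ ℓ₂)
  ℝ⁺ = Σ ℝ (0# <_)

  -- The library's Heyting field inverts differences: the inverse used is that
  -- of y - 0#.
  _/_ : ℝ → ℝ⁺ → ℝ
  x / (_ , 0<y) = x * proj₁ (#⇒invertible (#-sym (<⇒# 0<y)))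

  0<x+y : ∀ {x y} → 0# < x → 0# < y → 0# < x + y
  0<x+y {x} {y} 0<x 0<y =
    <-trans 0<y (<-respˡ (+-identityˡ y) (+-mono-< y 0<x))

  0<sum : ∀ {m} (f : Vector ℝ (suc m)) → (∀ l → 0# < f l) → 0# < sum f
  0<sum {zero}  f 0<f = <-respʳ (sym (+-identityʳ _)) (0<f zero)
  0<sum {suc m} f 0<f = 0<x+y (0<f zero) (0<sum (λ l → f (suc l)) (λ l → 0<f (suc l)))

  sum⁺ : ∀ {m} → Vector ℝ⁺ (suc m) → ℝ⁺
  sum⁺ f = sum (λ l → proj₁ (f l)) , 0<sum _ (λ l → proj₂ (f l))

  exp⁺ : ℝ → ℝ⁺
  exp⁺ x = exp x , 0<exp x

  0<fromℕ-suc : ∀ n → 0# < fromℕ (suc n)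
  0<fromℕ-suc zero    = <-respʳ (sym (+-identityʳ 1#)) 0<1
  0<fromℕ-suc (suc n) = 0<x+y 0<1 (0<fromℕ-suc n)

  Matrix : ℕ → ℕ → Set c
  Matrix m d = Vector (Vector ℝ d) m

  softmax : ∀ {m} → Vector ℝ (suc m) → Vector ℝ (suc m)
  softmax x l = exp (x l) / sum⁺ (λ l′ → exp⁺ (x l′))

  -- 1{ℓ > i - W} for the 1-based position ℓ = suc (toℕ l), rearranged to avoid
  -- truncated subtraction.
  mask : ℕ → ∀ {i} → Vector ℝ i
  mask W {i} l = if ⌊ i <? suc (toℕ l) ℕ.+ W ⌋ then 1# else 0#

  -- Positions outside the window get score 0, not -∞: their values still
  -- contribute, with unnormalised weight exp 0 = 1.
  Attn : ∀ (W : ℕ) {m d} →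
         Vector ℝ d → Matrix (suc m) d → Matrix (suc m) d → Vector ℝ d
  Attn W q K V j = sum (λ l → softmax h l * V l j)
    where
    S h : Vector ℝ _
    S l = sum (λ j′ → K l j′ * q j′)
    h l = S l * mask W l

  record Triple (d : ℕ) : Set c where
    constructor triple
    field
      query key value : Vec ℝ d

  open Triple

  qᵢ : ∀ {d n} → Vec (Triple d) n → Fin n → Vector ℝ d
  qᵢ xs i j = lookup (query (lookup xs i)) j

  -- The 0-based index i : Fin n stands for the update step suc (toℕ i).
  Kᵢ Vᵢ : ∀ {d n} → Vec (Triple d) n → (i : Fin n) → Matrix (suc (toℕ i)) d
  Kᵢ xs i l j = lookup (key   (lookup xs (inject≤ l (toℕ<n i)))) j
  Vᵢ xs i l j = lookup (value (lookup xs (inject≤ l (toℕ<n i)))) j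

  -- Randomised computations on a unit-cost real-number machine.
  -- A computation is the tree of its possible executions.  "step" is one
  -- operation that writes one real number; "flip p" succeeds with probability p
  -- (it compares p with a uniform number from [0, 1], which fixes its meaning
  -- for p outside [0, 1]); "sample ws" draws an index with probability
  -- proportional to the weights.  Distinct random choices are independent.
  -- Real arithmetic and every copying of a real number are charged as steps;
  -- loop counters and the links of queues are not.
  data Prog {a} (A : Set a) : Set (a ⊔ₗ c ⊔ₗ ℓ₂) where
    return : A → Prog A
    step   : Prog A → Prog A
    flip   : ℝ → (Bool → Prog A) → Prog A
    sample : ∀ {m} → Vec ℝ⁺ (suc m) → (Fin (suc m) → Prog A) → Prog A

  private variable
    a b e : Level
    A : Set a
    B : Set b
    C : Set e
    d m W : ℕ

  infixl 1 _>>=_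
  _>>=_ : Prog A → (A → Prog B) → Prog B
  return x    >>= f = f x
  step p      >>= f = step (p >>= f)
  flip r k    >>= f = flip r (λ x → k x >>= f)
  sample ws k >>= f = sample ws (λ x → k x >>= f)

  𝔼 : Prog A → (A → ℝ) → ℝ
  𝔼 (return x)    f = f x
  𝔼 (step p)      f = 𝔼 p f
  𝔼 (flip r k)    f = p * 𝔼 (k true) f + (1# - p) * 𝔼 (k false) f
    where
    p : ℝ
    p = 0# ⊔ (r ⊓ 1#)
  𝔼 (sample ws k) f =
    sum (λ l → (proj₁ (lookup ws l) / sum⁺ (lookup ws)) * 𝔼 (k l) f)

  maximum : Vector ℕ m → ℕ
  maximum = foldr ℕ._⊔_ 0

  -- Worst case over all executions.  Drawing from m weights costs m.
  time : Prog A → ℕ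
  time (return _)         = 0
  time (step p)           = suc (time p)
  time (flip _ k)         = suc (time (k true) ℕ.⊔ time (k false))
  time (sample {m} _ k)   = suc m ℕ.+ maximum (λ l → time (k l))

  -- Worst-case number of real numbers written.
  written : Prog A → ℕ
  written (return _)   = 0
  written (step p)     = suc (written p)
  written (flip _ k)   = written (k true) ℕ.⊔ written (k false)
  written (sample _ k) = maximum (λ l → written (k l))

  -- P holds for the result of every execution, even one of probability zero.
  Always : ∀ {p} → (A → Set p) → Prog A → Set p
  Always P (return x)   = P x
  Always P (step p)     = Always P p
  Always P (flip _ k)   = Always P (k true) × Always P (k false)
  Always P (sample _ k) = ∀ l → Always P (k l)

  op : A → Prog A
  op x = step (return x)

  bernoulli : ℝ → Prog Bool
  bernoulli p = flip p return

  choose : Vec ℝ⁺ (suc m) → Prog (Fin (suc m))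
  choose ws = sample ws return

  infixl 6 _⊕_ _⊖_ _⊕⁺_
  infixl 7 _⊗_ _⊘_
  _⊕_ _⊖_ _⊗_ : ℝ → ℝ → Prog ℝ
  x ⊕ y = op (x + y)
  x ⊖ y = op (x - y)
  x ⊗ y = op (x * y)

  _⊘_ : ℝ → ℝ⁺ → Prog ℝ
  x ⊘ y = op (x / y)

  _⊕⁺_ : ℝ⁺ → ℝ⁺ → Prog ℝ⁺
  (x , 0<x) ⊕⁺ (y , 0<y) = op (x + y , 0<x+y 0<x 0<y)

  mapM : (A → Prog B) → Vec A m → Prog (Vec B m)
  mapM f []       = return []
  mapM f (x ∷ xs) = do
    y  ← f x
    ys ← mapM f xs
    return (y ∷ ys)

  zipWithM : (A → B → Prog C) → Vec A m → Vec B m → Prog (Vec C m)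
  zipWithM f []       []       = return []
  zipWithM f (x ∷ xs) (y ∷ ys) = do
    z  ← f x y
    zs ← zipWithM f xs ys
    return (z ∷ zs)

  copy : Vec ℝ d → Prog (Vec ℝ d)
  copy = mapM op

  dot : Vec ℝ d → Vec ℝ d → Prog ℝ
  dot []       []       = op 0#
  dot (x ∷ xs) (y ∷ ys) = do
    p ← x ⊗ y
    r ← dot xs ys
    p ⊕ r

  total : Vec ℝ⁺ (suc m) → Prog ℝ⁺
  total (x ∷ [])     = op x
  total (x ∷ y ∷ ys) = do
    s ← total (y ∷ ys)
    x ⊕⁺ s

  weights : Vec ℝ d → Vec (Vec ℝ d) m → Prog (Vec ℝ⁺ m)
  weights q = mapM λ k → do
    s ← dot k q
    op (exp⁺ s)

  combine : Vec ℝ⁺ m → Vec (Vec ℝ d) m → Prog (Vec ℝ d)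
  combine []       []       = copy (replicate _ 0#)
  combine (w ∷ ws) (v ∷ vs) = do
    u ← mapM (proj₁ w ⊗_) v
    r ← combine ws vs
    zipWithM _⊕_ u r

  -- No masking: this is used only for i ≤ W, where the mask is constantly 1.
  directAttn : Vec ℝ d → Vec (Vec ℝ d) (suc m) → Vec (Vec ℝ d) (suc m) →
               Prog (Vec ℝ d)
  directAttn q K V = do
    ws ← weights q K
    Z  ← total ws
    u  ← combine ws V
    mapM (_⊘ Z) u

  -- "filling" holds m < W keys and values; "sliding t" has evicted t values so
  -- far and keeps the stored value vₛ among them.
  data State (d W : ℕ) : Set c where
    filling : m ℕ.< W → Vec (Vec ℝ d) m → Vec (Vec ℝ d) m → State d W
    sliding : (t : ℕ) → Vec (Vec ℝ d) W → Vec (Vec ℝ d) W → Maybe (Vec ℝ d) →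
              State d W

  stored : State d W → ℕ
  stored {d} {W} (filling {m} _ _ _) = m ℕ.* d ℕ.+ m ℕ.* d
  stored {d} {W} (sliding _ _ _ vₛ)  =
    W ℕ.* d ℕ.+ W ℕ.* d ℕ.+ maybe′ (λ _ → d) 0 vₛ

  initial : ∀ d W .{{_ : NonZero W}} → State d W
  initial d W = filling (>-nonZero⁻¹ W) [] []

  filled : m ℕ.< W → Vec (Vec ℝ d) (suc m) → Vec (Vec ℝ d) (suc m) → State d W
  filled m<W K V with m≤n⇒m<n∨m≡n m<W
  ... | inj₁ m+1<W = filling m+1<W K V
  ... | inj₂ refl  = sliding 0 K V nothing

  -- In the second clause the current step is i = W + suc t, so i - W = suc t.
  -- At t = 0 the replacement of vₛ = nothing has probability 1, so the default
  -- value for an empty vₛ is output with probability 0.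
  update : .{{NonZero W}} → Triple d → State d W → Prog (Vec ℝ d × State d W)
  update (triple q k v) (filling m<W K V) = do
    k′ ← copy k
    v′ ← copy v
    let K′ = K ∷ʳ k′
        V′ = V ∷ʳ v′
    o ← directAttn q K′ V′
    return (o , filled m<W K′ V′)
  update {W = suc _} (triple q k v) (sliding t (_ ∷ K) (v₁ ∷ V) vₛ) = do
    old ← copy v₁
    k′  ← copy k
    v′  ← copy v
    let K′ = K ∷ʳ k′
        V′ = V ∷ʳ v′
    N       ← op (fromℕ (suc t) , 0<fromℕ-suc t)
    r       ← 1# ⊘ N
    replace ← bernoulli r
    let vₛ′ = if replace then just old else vₛ
    ws     ← weights q K′
    E      ← total ws
    S      ← N ⊕⁺ E
    D      ← proj₁ S ⊖ proj₁ N
    p      ← D ⊘ S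
    inside ← bernoulli p
    o ← (if inside
         then (do l ← choose ws
                  copy (lookup V′ l))
         else copy (fromMaybe (replicate _ 0#) vₛ′))
    return (o , sliding (suc t) K′ V′ vₛ′)

  outputsFrom : ∀ {n} .{{_ : NonZero W}} → State d W →
                Vec (Triple d) n → Prog (Vec (Vec ℝ d) n)
  outputsFrom s []       = return []
  outputsFrom s (x ∷ xs) = do
    (o , s′) ← update x s
    os       ← outputsFrom s′ xs
    return (o ∷ os)

  -- The outputs O₁ , … , Oₙ.
  outputs : ∀ W .{{_ : NonZero W}} {n} → Vec (Triple d) n → Prog (Vec (Vec ℝ d) n)
  outputs W xs = outputsFrom (initial _ W) xs

  stateFrom : ∀ {n} .{{_ : NonZero W}} → State d W → Vec (Triple d) n →
              Fin n → Prog (State d W)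
  stateFrom s (x ∷ xs) zero    = return s
  stateFrom s (x ∷ xs) (suc i) = do
    (_ , s′) ← update x s
    stateFrom s′ xs i

  -- The state on which update step i acts.
  stateBefore : ∀ W .{{_ : NonZero W}} {n} → Vec (Triple d) n → Fin n →
                Prog (State d W)
  stateBefore W xs i = stateFrom (initial _ W) xs i

  -- Nothing is reclaimed before the update step ends: stored state, received
  -- triple and all intermediate results are counted, which bounds the number
  -- of real numbers held at any moment of the step.
  updateSpace : .{{NonZero W}} → Triple d → State d W → ℕ
  updateSpace {d = d} x s = stored s ℕ.+ 3 ℕ.* d ℕ.+ written (update x s)

  updateTime : .{{NonZero W}} → Triple d → State d W → ℕ
  updateTime x s = time (update x s)

module Submission where

-- Unbiasedness.  Fix a coordinate j.  The stored keys and values are determined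
-- by the input; the only random part of the state is the stored value vₛ from
-- outside the window, and it influences an output only linearly.  With N = t + 1
-- positions outside the window and total window weight E, the output step
-- returns vₛ with probability N / S, where S = N + E, and otherwise a window value
-- drawn with its softmax weight.  Hence S times its conditional expectation is
-- N vₛ + Σ wₗ vₗ (emit-output).  Replacing vₛ by the evicted value with
-- probability 1 / (t + 1) turns (t + 1) vₛ, in expectation, into t vₛ plus the
-- evicted value (reservoir).  So t vₛ behaves under expectation like the sum of
-- the t evicted values, and induction along the input shows that S times the
-- expected output is the sum of all values outside the window plus Σ wₗ vₗ
-- (sliding-expectation).  The masked scores outside the window are 0, with
-- exponential 1, so this is the softmax mean with its denominator cleared
-- (masked-split, masked-total).  Before the window is full, the mask is 1 and
-- the output is computed directly (filling-expectation).  Divisions are handled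
-- by cross-multiplication throughout, and the positive denominator is cancelled
-- at the very end (unbiased).
--
-- Cost.  The bound holds for an update from any state whatsoever.  Each of the
-- subprograms takes time at most a constant times d W, and the constants add up
-- to 17 (within-update).  The numbers written are at most the steps taken
-- (written≤time), and at most 3 d W numbers are stored (stored-bound).

open import Defs
open import Algebra.Bundles using (CommutativeRing)
open import Data.Bool.Base using (Bool; true; false; if_then_else_)
open import Data.Fin.Base using (Fin; zero; suc; toℕ; inject≤)
open import Data.Fin.Properties using (toℕ<n; toℕ-inject≤)
open import Data.Maybe.Base using (Maybe; just; nothing; fromMaybe)
open import Data.Nat.Base as ℕ using (ℕ; zero; suc; NonZero)
import Data.Nat.Properties as ℕₚ
open import Data.Product.Base using (∃; _×_; _,_; proj₁; proj₂)
open import Data.Sum.Base using (inj₁; inj₂)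
open import Data.Vec.Base using (Vec; []; _∷_; _∷ʳ_; lookup; replicate)
open import Data.Vec.Properties using (lookup-replicate)
open import Function.Base using (_∘_)
open import Level using (Level) renaming (_⊔_ to _⊔ₗ_)
open import Relation.Binary.Lattice.Structures using (IsLattice)
open import Relation.Binary.PropositionalEquality as ≡ using (_≡_)
open import Relation.Nullary.Decidable.Core using (⌊_⌋; yes; no)
open import Relation.Nullary.Negation.Core using (¬_; contradiction)

-- Ordered field arithmetic

module OrderedField {c ℓ₁ ℓ₂} (R : RealNumbers c ℓ₁ ℓ₂) where
  open RealNumbers R hiding (zero)
  open SlidingWindow R
  open IsLattice isLattice using (supremum; infimum; antisym)
    renaming (trans to ≤-trans; reflexive to ≤-reflexive)
  open import Relation.Binary.Reasoning.Setoid setoid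
  open import Algebra.Properties.Ring (CommutativeRing.ring commutativeRing) using (-0#≈0#)

  <⇒≤ : ∀ {x y} → x < y → x ≤ y
  <⇒≤ x<y y<x = <-irrefl refl (<-trans x<y y<x)

  x-0≈x : ∀ x → x - 0# ≈ x
  x-0≈x x = trans (+-congˡ -0#≈0#) (+-identityʳ x)

  x+y-x≈y : ∀ x y → (x + y) - x ≈ y
  x+y-x≈y x y = begin
    (x + y) - x  ≈⟨ +-congʳ (+-comm x y) ⟩
    (y + x) - x  ≈⟨ +-assoc y x (- x) ⟩
    y + (x - x)  ≈⟨ +-congˡ (-‿inverseʳ x) ⟩
    y + 0#       ≈⟨ +-identityʳ y ⟩
    y            ∎

  x+[y-x]≈y : ∀ x y → x + (y - x) ≈ y
  x+[y-x]≈y x y = trans (sym (+-assoc x y (- x))) (x+y-x≈y x y)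

  -- Division is characterised by cross-multiplication.
  /-* : ∀ x (y : ℝ⁺) → (x / y) * proj₁ y ≈ x
  /-* x (y , 0<y) with #⇒invertible (#-sym (<⇒# 0<y))
  ... | y⁻¹ , y⁻¹*y≈1 , _ = begin
    (x * y⁻¹) * y         ≈⟨ *-assoc x y⁻¹ y ⟩
    x * (y⁻¹ * y)         ≈⟨ *-congˡ (*-congˡ (x-0≈x y)) ⟨
    x * (y⁻¹ * (y - 0#))  ≈⟨ *-congˡ y⁻¹*y≈1 ⟩
    x * 1#                ≈⟨ *-identityʳ x ⟩
    x                     ∎

  -- Equations between expectations are proved after multiplication with the
  -- positive normalising factor, and this removes the factor.
  *-cancelʳ-pos : ∀ {x y z} → 0# < z → x * z ≈ y * z → x ≈ y
  *-cancelʳ-pos {x} {y} {z} 0<z xz≈yz = begin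
    x                ≈⟨ unit x ⟨
    (x * z) * 1/z    ≈⟨ *-congʳ xz≈yz ⟩
    (y * z) * 1/z    ≈⟨ unit y ⟩
    y                ∎
    where
    1/z : ℝ
    1/z = 1# / (z , 0<z)
    unit : ∀ w → (w * z) * 1/z ≈ w
    unit w = begin
      (w * z) * 1/z  ≈⟨ *-assoc w z 1/z ⟩
      w * (z * 1/z)  ≈⟨ *-congˡ (*-comm z 1/z) ⟩
      w * (1/z * z)  ≈⟨ *-congˡ (/-* 1# (z , 0<z)) ⟩
      w * 1#         ≈⟨ *-identityʳ w ⟩
      w              ∎

  +-cancelˡ : ∀ {x y z} → x + y ≈ x + z → y ≈ z
  +-cancelˡ {x} {y} {z} eq = begin
    y            ≈⟨ x+y-x≈y x y ⟨
    (x + y) - x  ≈⟨ +-congʳ eq ⟩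
    (x + z) - x  ≈⟨ x+y-x≈y x z ⟩
    z            ∎

  *-monoˡ-< : ∀ {x y z} → 0# < z → x < y → x * z < y * z
  *-monoˡ-< {x} {y} {z} 0<z x<y =
    <-respʳ eq (<-respˡ (+-identityˡ (x * z)) (+-mono-< (x * z) (*-pos 0<y-x 0<z)))
    where
    0<y-x : 0# < y - x
    0<y-x = <-respˡ (-‿inverseʳ x) (+-mono-< (- x) x<y)
    eq : (y - x) * z + x * z ≈ y * z
    eq = begin
      (y - x) * z + x * z  ≈⟨ distribʳ z (y - x) x ⟨
      ((y - x) + x) * z    ≈⟨ *-congʳ (+-comm (y - x) x) ⟩
      (x + (y - x)) * z    ≈⟨ *-congʳ (x+[y-x]≈y x y) ⟩
      y * z                ∎

  -- The probability with which a biased coin of parameter r succeeds.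
  clamp : ℝ → ℝ
  clamp r = 0# ⊔ (r ⊓ 1#)

  clamp-id : ∀ {r} → 0# ≤ r → r ≤ 1# → clamp r ≈ r
  clamp-id {r} 0≤r r≤1 = antisym
    (proj₂ (proj₂ (supremum 0# (r ⊓ 1#))) r 0≤r (proj₁ (infimum r 1#)))
    (≤-trans (proj₂ (proj₂ (infimum r 1#)) r (≤-reflexive refl) r≤1)
             (proj₁ (proj₂ (supremum 0# (r ⊓ 1#)))))

  -- The fraction x / (x + z) of nonnegative numbers lies in [0, 1], so that
  -- clamping it has no effect.
  clamp-/ : ∀ x z (y : ℝ⁺) → 0# ≤ x → 0# ≤ z → proj₁ y ≈ x + z →
            clamp (x / y) * proj₁ y ≈ x
  clamp-/ x z (y , 0<y) 0≤x 0≤z y≈x+z =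
    trans (*-congʳ (clamp-id 0≤r r≤1)) (/-* x (y , 0<y))
    where
    r : ℝ
    r = x / (y , 0<y)
    0≤r : 0# ≤ r
    0≤r r<0 = 0≤x (<-respˡ (/-* x (y , 0<y)) (<-respʳ (zeroˡ y) (*-monoˡ-< 0<y r<0)))
    r≤1 : r ≤ 1#
    r≤1 1<r = 0≤z
      (<-respʳ (-‿inverseʳ x)
      (<-respˡ (x+y-x≈y x z)
      (+-mono-< (- x)
      (<-respʳ (/-* x (y , 0<y))
      (<-respˡ (trans (*-identityˡ y) y≈x+z)
      (*-monoˡ-< 0<y 1<r))))))

  0≤fromℕ : ∀ n → 0# ≤ fromℕ n
  0≤fromℕ zero    = <-irrefl refl
  0≤fromℕ (suc n) = <⇒≤ (0<fromℕ-suc n)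

  exp-0 : exp 0# ≈ 1#
  exp-0 = *-cancelʳ-pos (0<exp 0#) (begin
    exp 0# * exp 0#  ≈⟨ exp-+ 0# 0# ⟨
    exp (0# + 0#)    ≈⟨ exp-cong (+-identityˡ 0#) ⟩
    exp 0#           ≈⟨ *-identityˡ (exp 0#) ⟨
    1# * exp 0#      ∎)

-- Expectations of programs

module Programs {c ℓ₁ ℓ₂} (R : RealNumbers c ℓ₁ ℓ₂) where
  open RealNumbers R hiding (zero)
  open SlidingWindow R
  open OrderedField R
  open import Relation.Binary.Reasoning.Setoid setoid
  open import Algebra.Properties.Semiring.Sum semiring
    using (sum-cong-≋; *-distribʳ-sum)

  private variable
    a b e p r : Level
    A : Set a
    B : Set b
    C : Set e
    d m : ℕ

  -- The mean of f over an index drawn with the weights ws, cleared of its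
  -- denominator.
  weighted-mean : (ws : Fin (suc m) → ℝ⁺) (f : Fin (suc m) → ℝ) →
    sum (λ l → (proj₁ (ws l) / sum⁺ ws) * f l) * proj₁ (sum⁺ ws)
      ≈ sum (λ l → proj₁ (ws l) * f l)
  weighted-mean ws f =
    trans (*-distribʳ-sum Z (λ l → (w l / sum⁺ ws) * f l)) (sum-cong-≋ λ l → begin
      ((w l / sum⁺ ws) * f l) * Z  ≈⟨ *-assoc (w l / sum⁺ ws) (f l) Z ⟩
      (w l / sum⁺ ws) * (f l * Z)  ≈⟨ *-congˡ (*-comm (f l) Z) ⟩
      (w l / sum⁺ ws) * (Z * f l)  ≈⟨ *-assoc (w l / sum⁺ ws) Z (f l) ⟨
      ((w l / sum⁺ ws) * Z) * f l  ≈⟨ *-congʳ (/-* (w l) (sum⁺ ws)) ⟩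
      w l * f l                    ∎)
    where
    Z : ℝ
    Z = proj₁ (sum⁺ ws)
    w : Fin _ → ℝ
    w l = proj₁ (ws l)

  convex-const : ∀ p x → p * x + (1# - p) * x ≈ x
  convex-const p x = begin
    p * x + (1# - p) * x  ≈⟨ distribʳ x p (1# - p) ⟨
    (p + (1# - p)) * x    ≈⟨ *-congʳ (x+[y-x]≈y p 1#) ⟩
    1# * x                ≈⟨ *-identityˡ x ⟩
    x                     ∎

  𝔼-cong : (p : Prog A) {f g : A → ℝ} → (∀ x → f x ≈ g x) → 𝔼 p f ≈ 𝔼 p g
  𝔼-cong (return x)    f≈g = f≈g x
  𝔼-cong (step p)      f≈g = 𝔼-cong p f≈g
  𝔼-cong (flip _ k)    f≈g =
    +-cong (*-congˡ (𝔼-cong (k true) f≈g)) (*-congˡ (𝔼-cong (k false) f≈g))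
  𝔼-cong (sample ws k) f≈g = sum-cong-≋ λ l →
    *-congˡ {x = proj₁ (lookup ws l) / sum⁺ (lookup ws)} (𝔼-cong (k l) f≈g)

  𝔼->>= : (p : Prog A) (k : A → Prog B) (f : B → ℝ) →
          𝔼 (p >>= k) f ≈ 𝔼 p (λ x → 𝔼 (k x) f)
  𝔼->>= (return x)     k f = refl
  𝔼->>= (step p)       k f = 𝔼->>= p k f
  𝔼->>= (flip _ k′)    k f =
    +-cong (*-congˡ (𝔼->>= (k′ true) k f)) (*-congˡ (𝔼->>= (k′ false) k f))
  𝔼->>= (sample ws k′) k f = sum-cong-≋ λ l →
    *-congˡ {x = proj₁ (lookup ws l) / sum⁺ (lookup ws)} (𝔼->>= (k′ l) k f)

  -- A quantity with the same value in every execution has that expectation.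
  𝔼-always : (p : Prog A) {f : A → ℝ} {z : ℝ} → Always (λ x → f x ≈ z) p → 𝔼 p f ≈ z
  𝔼-always (return x)    f≈z = f≈z
  𝔼-always (step p)      f≈z = 𝔼-always p f≈z
  𝔼-always (flip _ k) {z = z} (f≈z₁ , f≈z₂) = trans
    (+-cong (*-congˡ (𝔼-always (k true) f≈z₁)) (*-congˡ (𝔼-always (k false) f≈z₂)))
    (convex-const _ z)
  𝔼-always (sample ws k) {f} {z} f≈z = *-cancelʳ-pos (proj₂ Z⁺) (begin
    sum (λ l → (w l / Z⁺) * 𝔼 (k l) f) * proj₁ Z⁺
      ≈⟨ weighted-mean (lookup ws) (λ l → 𝔼 (k l) f) ⟩
    sum (λ l → w l * 𝔼 (k l) f)
      ≈⟨ sum-cong-≋ (λ l → *-congˡ {x = w l} (𝔼-always (k l) (f≈z l))) ⟩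
    sum (λ l → w l * z)
      ≈⟨ *-distribʳ-sum z w ⟨
    proj₁ Z⁺ * z
      ≈⟨ *-comm (proj₁ Z⁺) z ⟩
    z * proj₁ Z⁺ ∎)
    where
    Z⁺ : ℝ⁺
    Z⁺ = sum⁺ (lookup ws)
    w : Fin _ → ℝ
    w l = proj₁ (lookup ws l)

  always : {P : A → Set p} → (∀ x → P x) → (q : Prog A) → Always P q
  always h (return x)   = h x
  always h (step q)     = always h q
  always h (flip _ k)   = always h (k true) , always h (k false)
  always h (sample _ k) = λ l → always h (k l)

  always-then : {P : B → Set p} (q : Prog A) {k : A → Prog B} →
                (∀ x → Always P (k x)) → Always P (q >>= k)
  always-then (return x)   h = h x
  always-then (step q)     h = always-then q h
  always-then (flip _ k)   h = always-then (k true) h , always-then (k false) h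
  always-then (sample _ k) h = λ l → always-then (k l) h

  -- The program makes no random choice and its result satisfies P.  Such a
  -- program can be replaced by its result, about which only P is then known.
  data Computes {A : Set a} (P : A → Set p) : Prog A → Set (a ⊔ₗ c ⊔ₗ ℓ₂ ⊔ₗ p) where
    return : ∀ {x} → P x → Computes P (return x)
    step   : ∀ {q} → Computes P q → Computes P (step q)

  infixl 1 _>>=ᶜ_
  _>>=ᶜ_ : {P : A → Set p} {Q : B → Set r} {q : Prog A} {k : A → Prog B} →
           Computes P q → (∀ {x} → P x → Computes Q (k x)) → Computes Q (q >>= k)
  return px >>=ᶜ h = h px
  step cq   >>=ᶜ h = step (cq >>=ᶜ h)

  weaken : {P : A → Set p} {Q : A → Set r} {q : Prog A} →
           (∀ {x} → P x → Q x) → Computes P q → Computes Q q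
  weaken h (return px) = return (h px)
  weaken h (step cq)   = step (weaken h cq)

  -- Q is an arbitrary predicate, since programs that make no random choice
  -- preserve the expectation up to _≡_, not only up to _≈_.
  𝔼-computes : {P : A → Set p} {q : Prog A} {k : A → Prog B} {f : B → ℝ}
               (Q : ℝ → Set r) → Computes P q →
               (∀ {x} → P x → Q (𝔼 (k x) f)) → Q (𝔼 (q >>= k) f)
  𝔼-computes Q (return px) h = h px
  𝔼-computes Q (step cq)   h = 𝔼-computes Q cq h

  mapM-computes : {P : A → B → Set p} {f : A → Prog B} →
    (∀ x → Computes (P x) (f x)) → (xs : Vec A m) →
    Computes (λ ys → ∀ l → P (lookup xs l) (lookup ys l)) (mapM f xs)
  mapM-computes cf []       = return λ ()
  mapM-computes cf (x ∷ xs) =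
    cf x >>=ᶜ λ py → mapM-computes cf xs >>=ᶜ λ pys →
    return λ { zero → py ; (suc l) → pys l }

  zipWithM-computes : {P : A → B → C → Set p} {f : A → B → Prog C} →
    (∀ x y → Computes (P x y) (f x y)) → (xs : Vec A m) (ys : Vec B m) →
    Computes (λ zs → ∀ l → P (lookup xs l) (lookup ys l) (lookup zs l)) (zipWithM f xs ys)
  zipWithM-computes cf []       []       = return λ ()
  zipWithM-computes cf (x ∷ xs) (y ∷ ys) =
    cf x y >>=ᶜ λ pz → zipWithM-computes cf xs ys >>=ᶜ λ pzs →
    return λ { zero → pz ; (suc l) → pzs l }

  copy-computes : (v : Vec ℝ d) → Computes (v ≡_) (copy v)
  copy-computes []      = return ≡.refl
  copy-computes (x ∷ v) =
    step (copy-computes v >>=ᶜ λ v≡u → return (≡.cong (x ∷_) v≡u))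

  dot-computes : (xs ys : Vec ℝ d) →
    Computes (λ s → s ≈ sum (λ j → lookup xs j * lookup ys j)) (dot xs ys)
  dot-computes []       []       = step (return refl)
  dot-computes (x ∷ xs) (y ∷ ys) =
    step (dot-computes xs ys >>=ᶜ λ eq → step (return (+-congˡ eq)))

  total-computes : (ws : Vec ℝ⁺ (suc m)) →
    Computes (λ E → proj₁ E ≈ sum (λ l → proj₁ (lookup ws l))) (total ws)
  total-computes (x ∷ [])     = step (return (sym (+-identityʳ _)))
  total-computes (x ∷ y ∷ ws) =
    total-computes (y ∷ ws) >>=ᶜ λ eq → step (return (+-congˡ eq))

  -- The inner product of a query and a key.
  score : Vec ℝ d → Vec ℝ d → ℝ
  score q k = sum (λ j → lookup k j * lookup q j)

  -- The unnormalised softmax weight of a key.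
  weight : Vec ℝ d → Vec ℝ d → ℝ
  weight q k = exp (score q k)

  weights-computes : (q : Vec ℝ d) (K : Vec (Vec ℝ d) m) →
    Computes (λ ws → ∀ l → proj₁ (lookup ws l) ≈ weight q (lookup K l)) (weights q K)
  weights-computes q = mapM-computes {P = λ k w → proj₁ w ≈ weight q k} λ k →
    dot-computes k q >>=ᶜ λ eq → step (return (exp-cong eq))

  combine-computes : (ws : Vec ℝ⁺ m) (V : Vec (Vec ℝ d) m) →
    Computes (λ u → ∀ j → lookup u j ≈ sum (λ l → proj₁ (lookup ws l) * lookup (lookup V l) j))
             (combine ws V)
  combine-computes []       []      =
    weaken (λ { ≡.refl j → reflexive (lookup-replicate j 0#) }) (copy-computes (replicate _ 0#))
  combine-computes (w ∷ ws) (v ∷ V) =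
    mapM-computes {P = λ x y → y ≈ proj₁ w * x} (λ x → step (return refl)) v >>=ᶜ λ {u} scaled →
    combine-computes ws V >>=ᶜ λ {r} rest →
    weaken (λ added j → trans (added j) (+-cong (scaled j) (rest j)))
           (zipWithM-computes {P = λ x y z → z ≈ x + y} (λ x y → step (return refl)) u r)

  -- Directly computed coordinates are weighted means of the values, cleared of
  -- their denominator.
  directAttn-computes : (q : Vec ℝ d) (K V : Vec (Vec ℝ d) (suc m)) →
    Computes (λ o → ∀ j → lookup o j * sum (λ l → weight q (lookup K l))
                          ≈ sum (λ l → weight q (lookup K l) * lookup (lookup V l) j))
             (directAttn q K V)
  directAttn-computes q K V =
    weights-computes q K >>=ᶜ λ {ws} w≈ →
    total-computes ws >>=ᶜ λ {Z} Z≈ →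
    combine-computes ws V >>=ᶜ λ {u} u≈ →
    weaken (λ {o} o≈ j → begin
      lookup o j * sum (λ l → weight q (lookup K l))
        ≈⟨ *-congˡ (trans Z≈ (sum-cong-≋ w≈)) ⟨
      lookup o j * proj₁ Z
        ≈⟨ o≈ j ⟩
      lookup u j
        ≈⟨ u≈ j ⟩
      sum (λ l → proj₁ (lookup ws l) * lookup (lookup V l) j)
        ≈⟨ sum-cong-≋ (λ l → *-congʳ {x = lookup (lookup V l) j} (w≈ l)) ⟩
      sum (λ l → weight q (lookup K l) * lookup (lookup V l) j) ∎)
      (mapM-computes {P = λ x y → y * proj₁ Z ≈ x} (λ x → step (return (/-* x Z))) u)

-- One update in the sliding phase

module Updates {c ℓ₁ ℓ₂} (R : RealNumbers c ℓ₁ ℓ₂) where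
  open RealNumbers R hiding (zero)
  open SlidingWindow R
  open Triple
  open OrderedField R
  open Programs R
  open import Relation.Binary.Reasoning.Setoid setoid
  open import Algebra.Properties.Semiring.Sum semiring
    using (sum-cong-≋)

  open import Algebra.Properties.CommutativeSemigroup
    (CommutativeRing.+-commutativeSemigroup commutativeRing) using (interchange)

  private variable
    d m n W : ℕ

  -- The mean of x, taken with probability p = α / (α + β), and y.
  mixture : ∀ {p s α β} x y → p * s ≈ α → s ≈ α + β →
            (p * x + (1# - p) * y) * s ≈ α * x + β * y
  mixture {p} {s} {α} {β} x y ps≈α s≈α+β = begin
    (p * x + (1# - p) * y) * s        ≈⟨ distribʳ s (p * x) ((1# - p) * y) ⟩
    (p * x) * s + ((1# - p) * y) * s  ≈⟨ +-cong (swap p x) (swap (1# - p) y) ⟩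
    (p * s) * x + ((1# - p) * s) * y  ≈⟨ +-cong (*-congʳ ps≈α) (*-congʳ rest) ⟩
    α * x + β * y                     ∎
    where
    swap : ∀ u v → (u * v) * s ≈ (u * s) * v
    swap u v = begin
      (u * v) * s  ≈⟨ *-assoc u v s ⟩
      u * (v * s)  ≈⟨ *-congˡ (*-comm v s) ⟩
      u * (s * v)  ≈⟨ *-assoc u s v ⟨
      (u * s) * v  ∎
    rest : (1# - p) * s ≈ β
    rest = +-cancelˡ (begin
      p * s + (1# - p) * s  ≈⟨ convex-const p s ⟩
      s                     ≈⟨ s≈α+β ⟩
      α + β                 ≈⟨ +-congʳ ps≈α ⟨
      p * s + β             ∎)

  -- Coordinate j of the stored value from outside the window; the default for an
  -- empty store is zero.
  outside : Maybe (Vec ℝ d) → Fin d → ℝ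
  outside vₛ j = lookup (fromMaybe (replicate _ 0#) vₛ) j

  -- The part of an update in the sliding phase that follows the reservoir step:
  -- K and V are the shifted window, vₛ is the stored value after the possible
  -- replacement, t counts the evictions so far, and N is the weight given to the
  -- stored value.
  emit : Vec ℝ d → Vec (Vec ℝ d) (suc m) → Vec (Vec ℝ d) (suc m) → ℕ →
         Maybe (Vec ℝ d) → ℝ⁺ → Prog (Vec ℝ d × State d (suc m))
  emit q K V t vₛ N = do
    ws     ← weights q K
    E      ← total ws
    S      ← N ⊕⁺ E
    D      ← proj₁ S ⊖ proj₁ N
    p      ← D ⊘ S
    inside ← bernoulli p
    o ← (if inside
         then (do l ← choose ws
                  copy (lookup V l))
         else copy (fromMaybe (replicate _ 0#) vₛ))
    return (o , sliding t K V vₛ)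

  -- For a fixed stored value, the output is the weighted mean in which the stored
  -- value has weight N and each window value its softmax weight.
  emit-output : (q : Vec ℝ d) (K V : Vec (Vec ℝ d) (suc m)) (t : ℕ)
    (vₛ : Maybe (Vec ℝ d)) (N : ℝ⁺) (j : Fin d) →
    𝔼 (emit q K V t vₛ N) (λ r → lookup (proj₁ r) j)
        * (proj₁ N + sum (λ l → weight q (lookup K l)))
      ≈ proj₁ N * outside vₛ j
        + sum (λ l → weight q (lookup K l) * lookup (lookup V l) j)
  emit-output {d} {m} q K V t vₛ (N , 0<N) j =
    𝔼-computes Goal (weights-computes q K) λ {ws} w≈ →
    𝔼-computes Goal (total-computes ws) λ {E} E≈ → given ws w≈ E E≈
    where
    wK : Fin (suc m) → ℝ
    wK l = weight q (lookup K l)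
    vV : Fin (suc m) → ℝ
    vV l = lookup (lookup V l) j
    Goal : ℝ → Set _
    Goal e = e * (N + sum wK) ≈ N * outside vₛ j + sum (λ l → wK l * vV l)

    result : Vec ℝ d × State d (suc m) → ℝ
    result r = lookup (proj₁ r) j

    copied : (v : Vec ℝ d) →
      𝔼 (copy v >>= λ o → return (o , sliding t K V vₛ)) result ≈ lookup v j
    copied v = 𝔼-computes (_≈ lookup v j) (copy-computes v) λ { ≡.refl → refl }

    given : (ws : Vec ℝ⁺ (suc m)) → (∀ l → proj₁ (lookup ws l) ≈ wK l) →
      (E : ℝ⁺) → proj₁ E ≈ sum (λ l → proj₁ (lookup ws l)) →
      Goal (𝔼 ((N , 0<N) ⊕⁺ E >>= λ S → proj₁ S ⊖ N >>= λ D → D ⊘ S >>= λ p →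
               bernoulli p >>= λ inside →
               (if inside then (choose ws >>= λ l → copy (lookup V l))
                          else copy (fromMaybe (replicate _ 0#) vₛ)) >>= λ o →
               return (o , sliding t K V vₛ)) result)
    given ws w≈ (E , 0<E) E≈ = begin
      (p * drawn + (1# - p) * stay) * (N + sum wK)
        ≈⟨ *-congˡ (+-congˡ E≈ΣwK) ⟨
      (p * drawn + (1# - p) * stay) * (N + E)
        ≈⟨ mixture drawn stay p*S≈E (+-comm N E) ⟩
      E * drawn + N * stay
        ≈⟨ +-comm (E * drawn) (N * stay) ⟩
      N * stay + E * drawn
        ≈⟨ +-cong (*-congˡ (copied (fromMaybe (replicate _ 0#) vₛ))) E*drawn≈ ⟩
      N * outside vₛ j + sum (λ l → wK l * vV l) ∎
      where
      D p drawn stay : ℝ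
      D = (N + E) - N
      p = clamp (D / (N + E , 0<x+y 0<N 0<E))
      out : Fin (suc m) → ℝ
      out l = 𝔼 (copy (lookup V l) >>= λ o → return (o , sliding t K V vₛ)) result
      drawn = sum (λ l → (proj₁ (lookup ws l) / sum⁺ (lookup ws)) * out l)
      stay = 𝔼 (copy (fromMaybe (replicate _ 0#) vₛ) >>= λ o →
                return (o , sliding t K V vₛ)) result

      E≈ΣwK : E ≈ sum wK
      E≈ΣwK = trans E≈ (sum-cong-≋ w≈)

      D≈E : D ≈ E
      D≈E = x+y-x≈y N E

      p*S≈E : p * (N + E) ≈ E
      p*S≈E = trans
        (clamp-/ D N (N + E , 0<x+y 0<N 0<E) (<⇒≤ (<-respʳ (sym D≈E) 0<E)) (<⇒≤ 0<N)
                 (trans (+-comm N E) (+-congʳ (sym D≈E))))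
        D≈E

      E*drawn≈ : E * drawn ≈ sum (λ l → wK l * vV l)
      E*drawn≈ = begin
        E * drawn
          ≈⟨ *-comm E drawn ⟩
        drawn * E
          ≈⟨ *-congˡ E≈ ⟩
        drawn * proj₁ (sum⁺ (lookup ws))
          ≈⟨ weighted-mean (lookup ws) out ⟩
        sum (λ l → proj₁ (lookup ws l) * out l)
          ≈⟨ sum-cong-≋ (λ l → *-cong (w≈ l) (copied (lookup V l))) ⟩
        sum (λ l → wK l * vV l) ∎

  emit-state : (q : Vec ℝ d) (K V : Vec (Vec ℝ d) (suc m)) (t : ℕ)
    (vₛ : Maybe (Vec ℝ d)) (N : ℝ⁺) (f : State d (suc m) → ℝ) →
    𝔼 (emit q K V t vₛ N) (λ r → f (proj₂ r)) ≈ f (sliding t K V vₛ)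
  emit-state q K V t vₛ N f = 𝔼-always (emit q K V t vₛ N)
    (always-then (weights q K) λ ws →
     always-then (total ws) λ E →
     (λ l → always-then (copy (lookup V l)) λ _ → refl) ,
     always-then (copy (fromMaybe (replicate _ 0#) vₛ)) λ _ → refl)

  -- Reservoir sampling.  Let f be a quantity whose expectation after the
  -- reservoir step depends affinely on suc t times the stored value.  The step
  -- stores the evicted value v₁ with probability 1 / suc t, so its expectation
  -- before the step is the same expression with t times the old stored value
  -- plus v₁ instead.  For t = 0 the old stored value drops out, so the default
  -- for an empty store does not matter.
  reservoir : (x : Triple d) (t : ℕ)
    (k₁ v₁ : Vec ℝ d) (K V : Vec (Vec ℝ d) m) (vₛ : Maybe (Vec ℝ d))
    (f : Vec ℝ d × State d (suc m) → ℝ) (j : Fin d) (z b : ℝ) →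
    (∀ vₛ′ → 𝔼 (emit (query x) (K ∷ʳ key x) (V ∷ʳ value x) (suc t) vₛ′
                     (fromℕ (suc t) , 0<fromℕ-suc t)) f * z
               ≈ fromℕ (suc t) * outside vₛ′ j + b) →
    𝔼 (update x (sliding t (k₁ ∷ K) (v₁ ∷ V) vₛ)) f * z
      ≈ fromℕ t * outside vₛ j + (lookup v₁ j + b)
  reservoir (triple q k v) t k₁ v₁ K V vₛ f j z b emitted =
    𝔼-computes Goal (copy-computes v₁) λ { ≡.refl →
    𝔼-computes Goal (copy-computes k) λ { ≡.refl →
    𝔼-computes Goal (copy-computes v) λ { ≡.refl → mixed } } }
    where
    Goal : ℝ → Set _
    Goal e = e * z ≈ fromℕ t * outside vₛ j + (lookup v₁ j + b)

    N : ℝ⁺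
    N = fromℕ (suc t) , 0<fromℕ-suc t
    p new old : ℝ
    -- The probability of replacing the stored value.
    p = clamp (1# / N)
    new = lookup v₁ j
    old = outside vₛ j
    G : Maybe (Vec ℝ _) → ℝ
    G vₛ′ = 𝔼 (emit q (K ∷ʳ k) (V ∷ʳ v) (suc t) vₛ′ N) f

    p*N≈1 : p * proj₁ N ≈ 1#
    p*N≈1 = clamp-/ 1# (fromℕ t) N (<⇒≤ 0<1) (0≤fromℕ t) refl

    mixed : Goal (p * G (just v₁) + (1# - p) * G vₛ)
    mixed = begin
      (p * G (just v₁) + (1# - p) * G vₛ) * z
        ≈⟨ distribʳ z _ _ ⟩
      (p * G (just v₁)) * z + ((1# - p) * G vₛ) * z
        ≈⟨ +-cong (scaled p (just v₁)) (scaled (1# - p) vₛ) ⟩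
      ((p * new) * proj₁ N + p * b) + (((1# - p) * old) * proj₁ N + (1# - p) * b)
        ≈⟨ interchange _ _ _ _ ⟩
      ((p * new) * proj₁ N + ((1# - p) * old) * proj₁ N) + (p * b + (1# - p) * b)
        ≈⟨ +-cong (sym (distribʳ (proj₁ N) _ _)) (convex-const p b) ⟩
      (p * new + (1# - p) * old) * proj₁ N + b
        ≈⟨ +-congʳ (mixture new old p*N≈1 refl) ⟩
      (1# * new + fromℕ t * old) + b
        ≈⟨ +-congʳ (+-congʳ (*-identityˡ new)) ⟩
      (new + fromℕ t * old) + b
        ≈⟨ +-congʳ (+-comm new _) ⟩
      (fromℕ t * old + new) + b
        ≈⟨ +-assoc _ new b ⟩
      fromℕ t * old + (new + b) ∎
      where
      scaled : ∀ u vₛ′ → (u * G vₛ′) * z ≈ (u * outside vₛ′ j) * proj₁ N + u * b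
      scaled u vₛ′ = begin
        (u * G vₛ′) * z                            ≈⟨ *-assoc u (G vₛ′) z ⟩
        u * (G vₛ′ * z)                            ≈⟨ *-congˡ (emitted vₛ′) ⟩
        u * (proj₁ N * outside vₛ′ j + b)          ≈⟨ distribˡ u _ b ⟩
        u * (proj₁ N * outside vₛ′ j) + u * b      ≈⟨ +-congʳ (*-congˡ (*-comm (proj₁ N) _)) ⟩
        u * (outside vₛ′ j * proj₁ N) + u * b      ≈⟨ +-congʳ (*-assoc u _ (proj₁ N)) ⟨
        (u * outside vₛ′ j) * proj₁ N + u * b      ∎

  coordinate : Fin n → Fin d → Vec (Vec ℝ d) n → ℝ
  coordinate i j O = lookup (lookup O i) j

  outputs-zero : .{{_ : NonZero W}} (s : State d W) (x : Triple d)
    (xs : Vec (Triple d) n) (j : Fin d) →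
    𝔼 (outputsFrom s (x ∷ xs)) (coordinate zero j)
      ≈ 𝔼 (update x s) (λ r → lookup (proj₁ r) j)
  outputs-zero s x xs j = trans
    (𝔼->>= (update x s) _ (coordinate zero j))
    (𝔼-cong (update x s) λ (o , s′) →
      𝔼-always (outputsFrom s′ xs >>= λ os → return (o ∷ os))
               (always-then (outputsFrom s′ xs) λ _ → refl))

  outputs-suc : .{{_ : NonZero W}} (s : State d W) (x : Triple d)
    (xs : Vec (Triple d) n) (i : Fin n) (j : Fin d) →
    𝔼 (outputsFrom s (x ∷ xs)) (coordinate (suc i) j)
      ≈ 𝔼 (update x s) (λ r → 𝔼 (outputsFrom (proj₂ r) xs) (coordinate i j))
  outputs-suc s x xs i j = trans
    (𝔼->>= (update x s) _ (coordinate (suc i) j))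
    (𝔼-cong (update x s) λ (o , s′) →
      𝔼->>= (outputsFrom s′ xs) _ (coordinate (suc i) j))

-- The expected output at each step

module Expectation {c ℓ₁ ℓ₂} (R : RealNumbers c ℓ₁ ℓ₂) where
  open RealNumbers R hiding (zero)
  open SlidingWindow R
  open Triple
  open OrderedField R
  open Programs R
  open Updates R
  open import Relation.Binary.Reasoning.Setoid setoid
  open import Algebra.Properties.Semiring.Sum semiring
    using (sum-cong-≋; sum-replicate)

  private variable
    a e : Level
    A : Set a
    B : Set e
    d m n W : ℕ

  -- The sum of f 0 , … , f (n - 1).
  Σ< : ℕ → (ℕ → ℝ) → ℝ
  Σ< n f = sum {n} λ l → f (toℕ l)

  Σ<-cong : ∀ n (f g : ℕ → ℝ) → (∀ l → l ℕ.< n → f l ≈ g l) → Σ< n f ≈ Σ< n g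
  Σ<-cong n f g f≈g = sum-cong-≋ λ l → f≈g (toℕ l) (toℕ<n l)

  Σ<-+ : ∀ m n (f : ℕ → ℝ) → Σ< (m ℕ.+ n) f ≈ Σ< m f + Σ< n (λ l → f (m ℕ.+ l))
  Σ<-+ zero    n f = sym (+-identityˡ _)
  Σ<-+ (suc m) n f = trans (+-congˡ (Σ<-+ m n (f ∘ suc))) (sym (+-assoc _ _ _))

  Σ<-1 : ∀ n → Σ< n (λ _ → 1#) ≈ fromℕ n
  Σ<-1 n = sum-replicate n

  -- xs lists the first terms of the sequence f.
  _Prefixes_ : {A : Set a} → Vec A n → (ℕ → A) → Set a
  xs Prefixes f = ∀ l → lookup xs l ≡ f (toℕ l)

  prefixes-∷ʳ : (xs : Vec A n) (f : ℕ → A) {x : A} →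
                xs Prefixes f → x ≡ f n → (xs ∷ʳ x) Prefixes f
  prefixes-∷ʳ []       f _   x≡ zero    = x≡
  prefixes-∷ʳ (_ ∷ xs) f xs≡ x≡ zero    = xs≡ zero
  prefixes-∷ʳ (_ ∷ xs) f xs≡ x≡ (suc l) = prefixes-∷ʳ xs (f ∘ suc) (xs≡ ∘ suc) x≡ l

  prefixes-head : ∀ m (f : ℕ → A) {x : A} {xs : Vec A n} →
                  (x ∷ xs) Prefixes (λ l → f (m ℕ.+ l)) → x ≡ f m
  prefixes-head m f xs≡ = ≡.trans (xs≡ zero) (≡.cong f (ℕₚ.+-identityʳ m))

  prefixes-tail : ∀ m (f : ℕ → A) {x : A} {xs : Vec A n} →
                  (x ∷ xs) Prefixes (λ l → f (m ℕ.+ l)) →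
                  xs Prefixes (λ l → f (suc m ℕ.+ l))
  prefixes-tail m f xs≡ l = ≡.trans (xs≡ (suc l)) (≡.cong f (ℕₚ.+-suc m (toℕ l)))

  -- The entries of xs, continued by the constant x₀.
  sequence : A → Vec A n → ℕ → A
  sequence x₀ []       _       = x₀
  sequence x₀ (x ∷ xs) zero    = x
  sequence x₀ (x ∷ xs) (suc l) = sequence x₀ xs l

  prefixes-sequence : (x₀ : A) (xs : Vec A n) → xs Prefixes sequence x₀ xs
  prefixes-sequence x₀ (x ∷ xs) zero    = ≡.refl
  prefixes-sequence x₀ (x ∷ xs) (suc l) = prefixes-sequence x₀ xs l

  -- The unmasked softmax weight of position l of a stream, and coordinate j of its
  -- value.
  keyWeight : Vec ℝ d → (ℕ → Triple d) → ℕ → ℝ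
  keyWeight q s l = weight q (key (s l))

  valueAt : Fin d → (ℕ → Triple d) → ℕ → ℝ
  valueAt j s l = lookup (value (s l)) j

  sum-prefix : (g : A → ℝ) (xs : Vec A n) (f : ℕ → A) → xs Prefixes f →
               sum (λ l → g (lookup xs l)) ≈ Σ< n (λ l → g (f l))
  sum-prefix g xs f xs≡ = sum-cong-≋ λ l → reflexive (≡.cong g (xs≡ l))

  sum-prefix₂ : (g : A → ℝ) (g′ : B → ℝ)
    (xs : Vec A n) (ys : Vec B n) (f : ℕ → A) (f′ : ℕ → B) → xs Prefixes f → ys Prefixes f′ →
    sum (λ l → g (lookup xs l) * g′ (lookup ys l)) ≈ Σ< n (λ l → g (f l) * g′ (f′ l))
  sum-prefix₂ g g′ xs ys f f′ xs≡ ys≡ = sum-cong-≋ λ l →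
    reflexive (≡.cong₂ (λ x y → g x * g′ y) (xs≡ l) (ys≡ l))

  -- The total weight of the window s N , … , s (N + W - 1), and the weighted sum
  -- of its values.
  windowWeight : ℕ → Vec ℝ d → (ℕ → Triple d) → ℕ → ℝ
  windowWeight W q s N = Σ< W λ l → keyWeight q s (N ℕ.+ l)

  windowValue : ℕ → Vec ℝ d → (ℕ → Triple d) → Fin d → ℕ → ℝ
  windowValue W q s j N = Σ< W λ l → keyWeight q s (N ℕ.+ l) * valueAt j s (N ℕ.+ l)

  -- In a sliding state after t evictions, let s list the window followed by the
  -- triples xs still to come.  Step i of xs, counted from 0, shifts the window by
  -- N = suc i positions in all.  The expected output is then a weighted mean in
  -- which each of the t + N positions outside the window has weight 1, with the
  -- stored value standing for the first t of them.  The induction on xs moves the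
  -- window along by replacing s with s ∘ suc.
  sliding-expectation : (s : ℕ → Triple d) (t : ℕ)
    (K V : Vec (Vec ℝ d) (suc m)) (vₛ : Maybe (Vec ℝ d)) (xs : Vec (Triple d) n) →
    K Prefixes (key ∘ s) → V Prefixes (value ∘ s) →
    xs Prefixes (λ l → s (suc m ℕ.+ l)) →
    (i : Fin n) (j : Fin d) →
    let q = query (lookup xs i)
        N = suc (toℕ i)
    in 𝔼 (outputsFrom (sliding t K V vₛ) xs) (coordinate i j)
         * (fromℕ (t ℕ.+ N) + windowWeight (suc m) q s N)
       ≈ fromℕ t * outside vₛ j + (Σ< N (valueAt j s) + windowValue (suc m) q s j N)
  sliding-expectation {m = m} s t (k₁ ∷ K) (v₁ ∷ V) vₛ (x ∷ xs) K≡ V≡ xs≡ zero j = begin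
    𝔼 (outputsFrom (sliding t (k₁ ∷ K) (v₁ ∷ V) vₛ) (x ∷ xs)) (coordinate zero j)
        * (fromℕ (t ℕ.+ 1) + z)
      ≈⟨ *-cong (outputs-zero (sliding t (k₁ ∷ K) (v₁ ∷ V) vₛ) x xs j)
                (+-congʳ (reflexive (≡.cong fromℕ (ℕₚ.+-comm t 1)))) ⟩
    𝔼 (update x (sliding t (k₁ ∷ K) (v₁ ∷ V) vₛ)) (λ r → lookup (proj₁ r) j)
        * (fromℕ (suc t) + z)
      ≈⟨ reservoir x t k₁ v₁ K V vₛ _ j _ b emitted ⟩
    fromℕ t * outside vₛ j + (lookup v₁ j + b)
      ≈⟨ +-congˡ (+-congʳ (trans (reflexive v₁≡) (sym (+-identityʳ _)))) ⟩
    fromℕ t * outside vₛ j + (Σ< 1 (valueAt j s) + b) ∎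
    where
    z b : ℝ
    z = windowWeight (suc m) (query x) s 1
    b = windowValue (suc m) (query x) s j 1
    v₁≡ : lookup v₁ j ≡ valueAt j s 0
    v₁≡ = ≡.cong (λ v → lookup v j) (V≡ zero)
    x≡ : x ≡ s (suc m)
    x≡ = prefixes-head (suc m) s xs≡
    K′≡ : (K ∷ʳ key x) Prefixes (key ∘ s ∘ suc)
    K′≡ = prefixes-∷ʳ K (key ∘ s ∘ suc) (K≡ ∘ suc) (≡.cong key x≡)
    V′≡ : (V ∷ʳ value x) Prefixes (value ∘ s ∘ suc)
    V′≡ = prefixes-∷ʳ V (value ∘ s ∘ suc) (V≡ ∘ suc) (≡.cong value x≡)
    emitted : ∀ vₛ′ →
      𝔼 (emit (query x) (K ∷ʳ key x) (V ∷ʳ value x) (suc t) vₛ′ _) (λ r → lookup (proj₁ r) j)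
        * (fromℕ (suc t) + z) ≈ fromℕ (suc t) * outside vₛ′ j + b
    emitted vₛ′ = begin
      _ * (fromℕ (suc t) + z)
        ≈⟨ *-congˡ (+-congˡ (sum-prefix (weight (query x)) (K ∷ʳ key x) (key ∘ s ∘ suc) K′≡)) ⟨
      _ ≈⟨ emit-output (query x) (K ∷ʳ key x) (V ∷ʳ value x) (suc t) vₛ′ _ j ⟩
      _ ≈⟨ +-congˡ (sum-prefix₂ (weight (query x)) (λ v → lookup v j)
          (K ∷ʳ key x) (V ∷ʳ value x) (key ∘ s ∘ suc) (value ∘ s ∘ suc) K′≡ V′≡) ⟩
      fromℕ (suc t) * outside vₛ′ j + b ∎
  sliding-expectation {m = m} s t (k₁ ∷ K) (v₁ ∷ V) vₛ (x ∷ xs) K≡ V≡ xs≡ (suc i) j = begin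
    𝔼 (outputsFrom (sliding t (k₁ ∷ K) (v₁ ∷ V) vₛ) (x ∷ xs)) (coordinate (suc i) j)
        * (fromℕ (t ℕ.+ suc N) + z)
      ≈⟨ *-cong (outputs-suc (sliding t (k₁ ∷ K) (v₁ ∷ V) vₛ) x xs i j)
                (+-congʳ (reflexive (≡.cong fromℕ (ℕₚ.+-suc t N)))) ⟩
    𝔼 (update x (sliding t (k₁ ∷ K) (v₁ ∷ V) vₛ)) (λ r → rest (proj₂ r))
        * (fromℕ (suc t ℕ.+ N) + z)
      ≈⟨ reservoir x t k₁ v₁ K V vₛ _ j _ b emitted ⟩
    fromℕ t * outside vₛ j + (lookup v₁ j + b)
      ≈⟨ +-congˡ (trans (+-congʳ (reflexive v₁≡)) (sym (+-assoc _ _ _))) ⟩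
    fromℕ t * outside vₛ j
      + (Σ< (suc N) (valueAt j s) + windowValue (suc m) q s j (suc N)) ∎
    where
    q : Vec ℝ _
    q = query (lookup xs i)
    N : ℕ
    N = suc (toℕ i)
    rest : State _ (suc m) → ℝ
    rest s′ = 𝔼 (outputsFrom s′ xs) (coordinate i j)
    z b : ℝ
    z = windowWeight (suc m) q s (suc N)
    b = Σ< N (valueAt j (s ∘ suc)) + windowValue (suc m) q s j (suc N)
    v₁≡ : lookup v₁ j ≡ valueAt j s 0
    v₁≡ = ≡.cong (λ v → lookup v j) (V≡ zero)
    x≡ : x ≡ s (suc m)
    x≡ = prefixes-head (suc m) s xs≡
    K′≡ : (K ∷ʳ key x) Prefixes (key ∘ s ∘ suc)
    K′≡ = prefixes-∷ʳ K (key ∘ s ∘ suc) (K≡ ∘ suc) (≡.cong key x≡)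
    V′≡ : (V ∷ʳ value x) Prefixes (value ∘ s ∘ suc)
    V′≡ = prefixes-∷ʳ V (value ∘ s ∘ suc) (V≡ ∘ suc) (≡.cong value x≡)
    emitted : ∀ vₛ′ →
      𝔼 (emit (query x) (K ∷ʳ key x) (V ∷ʳ value x) (suc t) vₛ′ _) (λ r → rest (proj₂ r))
        * (fromℕ (suc t ℕ.+ N) + z) ≈ fromℕ (suc t) * outside vₛ′ j + b
    emitted vₛ′ = trans
      (*-congʳ (emit-state (query x) (K ∷ʳ key x) (V ∷ʳ value x) (suc t) vₛ′ _ rest))
      (sliding-expectation (s ∘ suc) (suc t) (K ∷ʳ key x) (V ∷ʳ value x) vₛ′ xs
        K′≡ V′≡ (prefixes-tail (suc m) s xs≡) i j)

  -- The exponential of the masked score of the 0-based position l at step i.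
  maskedWeight : ℕ → Vec ℝ d → (ℕ → Triple d) → ℕ → ℕ → ℝ
  maskedWeight W q s i l =
    exp (score q (key (s l)) * (if ⌊ i ℕₚ.<? suc l ℕ.+ W ⌋ then 1# else 0#))

  maskedWeight-inside : ∀ W (q : Vec ℝ d) s i l → i ℕ.< suc l ℕ.+ W →
                        maskedWeight W q s i l ≈ keyWeight q s l
  maskedWeight-inside W q s i l i<l+W with i ℕₚ.<? suc l ℕ.+ W
  ... | yes _    = exp-cong (*-identityʳ _)
  ... | no i≮l+W = contradiction i<l+W i≮l+W

  maskedWeight-outside : ∀ W (q : Vec ℝ d) s i l → ¬ i ℕ.< suc l ℕ.+ W →
                         maskedWeight W q s i l ≈ 1#
  maskedWeight-outside W q s i l i≮l+W with i ℕₚ.<? suc l ℕ.+ W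
  ... | yes i<l+W = contradiction i<l+W i≮l+W
  ... | no _      = trans (exp-cong (zeroʳ _)) exp-0

  -- At step N + W the first N positions are outside the window.
  masked-split : ∀ (W N : ℕ) (q : Vec ℝ d) s (f : ℕ → ℝ) →
    Σ< (N ℕ.+ W) (λ l → maskedWeight W q s (N ℕ.+ W) l * f l)
      ≈ Σ< N f + Σ< W (λ l → keyWeight q s (N ℕ.+ l) * f (N ℕ.+ l))
  masked-split W N q s f = trans (Σ<-+ N W g) (+-cong
    (Σ<-cong N g f λ l l<N → trans
      (*-congʳ (maskedWeight-outside W q s (N ℕ.+ W) l (ℕₚ.≤⇒≯ (ℕₚ.+-monoˡ-≤ W l<N))))
      (*-identityˡ (f l)))
    (Σ<-cong W (λ l → g (N ℕ.+ l)) (λ l → keyWeight q s (N ℕ.+ l) * f (N ℕ.+ l)) λ l _ →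
      *-congʳ {x = f (N ℕ.+ l)} (maskedWeight-inside W q s (N ℕ.+ W) (N ℕ.+ l)
        (ℕ.s≤s (ℕₚ.+-monoˡ-≤ W (ℕₚ.m≤m+n N l))))))
    where
    g : ℕ → ℝ
    g l = maskedWeight W q s (N ℕ.+ W) l * f l

  masked-total : ∀ (W N : ℕ) (q : Vec ℝ d) s →
    Σ< (N ℕ.+ W) (maskedWeight W q s (N ℕ.+ W)) ≈ fromℕ N + windowWeight W q s N
  masked-total W N q s = begin
    Σ< (N ℕ.+ W) (maskedWeight W q s (N ℕ.+ W))
      ≈⟨ Σ<-cong (N ℕ.+ W) (λ l → w l * 1#) w (λ l _ → *-identityʳ (w l)) ⟨
    Σ< (N ℕ.+ W) (λ l → maskedWeight W q s (N ℕ.+ W) l * 1#)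
      ≈⟨ masked-split W N q s (λ _ → 1#) ⟩
    Σ< N (λ _ → 1#) + Σ< W (λ l → keyWeight q s (N ℕ.+ l) * 1#)
      ≈⟨ +-cong (Σ<-1 N) (Σ<-cong W (λ l → u l * 1#) u λ l _ → *-identityʳ (u l)) ⟩
    fromℕ N + windowWeight W q s N ∎
    where
    w u : ℕ → ℝ
    w = maskedWeight W q s (N ℕ.+ W)
    u l = keyWeight q s (N ℕ.+ l)

  -- e is coordinate j of the attention for the query q at step N, expressed by
  -- multiplication with the normalising factor of the softmax.
  IsAttention : ℕ → (ℕ → Triple d) → Vec ℝ d → Fin d → ℕ → ℝ → Set ℓ₁
  IsAttention W s q j N e =
    e * Σ< N (maskedWeight W q s N) ≈ Σ< N (λ l → maskedWeight W q s N l * valueAt j s l)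

  -- The states before the window is full hold the first m triples of s, and xs
  -- lists the later ones.
  filling-expectation : .{{_ : NonZero W}} (s : ℕ → Triple d) (m<W : m ℕ.< W)
    (K V : Vec (Vec ℝ d) m) (xs : Vec (Triple d) n) →
    K Prefixes (key ∘ s) → V Prefixes (value ∘ s) → xs Prefixes (λ l → s (m ℕ.+ l)) →
    (i : Fin n) (j : Fin d) →
    IsAttention W s (query (lookup xs i)) j (suc m ℕ.+ toℕ i)
      (𝔼 (outputsFrom (filling m<W K V) xs) (coordinate i j))

  filled-expectation : .{{_ : NonZero W}} (s : ℕ → Triple d) (m<W : m ℕ.< W)
    (K V : Vec (Vec ℝ d) (suc m)) (xs : Vec (Triple d) n) →
    K Prefixes (key ∘ s) → V Prefixes (value ∘ s) → xs Prefixes (λ l → s (suc m ℕ.+ l)) →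
    (i : Fin n) (j : Fin d) →
    IsAttention W s (query (lookup xs i)) j (suc (suc m) ℕ.+ toℕ i)
      (𝔼 (outputsFrom (filled m<W K V) xs) (coordinate i j))

  filling-expectation {W = W} {m = m} s m<W K V (x ∷ xs) K≡ V≡ xs≡ zero j
    rewrite ℕₚ.+-identityʳ m = begin
      _ * Σ< (suc m) (maskedWeight W q s (suc m))
        ≈⟨ *-cong (outputs-zero (filling m<W K V) x xs j)
                  (trans (Σ<-cong (suc m) (maskedWeight W q s (suc m)) (keyWeight q s)
                                 (λ l _ → unmasked l))
                         (sym (sum-prefix (weight q) (K ∷ʳ key x) (key ∘ s) K′≡))) ⟩
      𝔼 (update x (filling m<W K V)) (λ r → lookup (proj₁ r) j)
          * sum (λ l → weight q (lookup (K ∷ʳ key x) l))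
        ≈⟨ computed ⟩
      sum (λ l → weight q (lookup (K ∷ʳ key x) l) * lookup (lookup (V ∷ʳ value x) l) j)
        ≈⟨ sum-prefix₂ (weight q) (λ v → lookup v j)
          (K ∷ʳ key x) (V ∷ʳ value x) (key ∘ s) (value ∘ s) K′≡ V′≡ ⟩
      Σ< (suc m) (λ l → keyWeight q s l * valueAt j s l)
        ≈⟨ Σ<-cong (suc m) (λ l → maskedWeight W q s (suc m) l * valueAt j s l)
                           (λ l → keyWeight q s l * valueAt j s l)
                           (λ l _ → *-congʳ {x = valueAt j s l} (unmasked l)) ⟨
      Σ< (suc m) (λ l → maskedWeight W q s (suc m) l * valueAt j s l) ∎
    where
    q : Vec ℝ _
    q = query x
    x≡ : x ≡ s m
    x≡ = prefixes-head m s xs≡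
    K′≡ : (K ∷ʳ key x) Prefixes (key ∘ s)
    K′≡ = prefixes-∷ʳ K (key ∘ s) K≡ (≡.cong key x≡)
    V′≡ : (V ∷ʳ value x) Prefixes (value ∘ s)
    V′≡ = prefixes-∷ʳ V (value ∘ s) V≡ (≡.cong value x≡)
    unmasked : ∀ l → maskedWeight W q s (suc m) l ≈ keyWeight q s l
    unmasked l = maskedWeight-inside W q s (suc m) l (ℕ.s≤s (ℕₚ.≤-trans m<W (ℕₚ.m≤n+m W l)))
    Goal : ℝ → Set _
    Goal e = e * sum (λ l → weight q (lookup (K ∷ʳ key x) l))
             ≈ sum (λ l → weight q (lookup (K ∷ʳ key x) l) * lookup (lookup (V ∷ʳ value x) l) j)
    computed : Goal (𝔼 (update x (filling m<W K V)) (λ r → lookup (proj₁ r) j))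
    computed =
      𝔼-computes Goal (copy-computes (key x)) λ { ≡.refl →
      𝔼-computes Goal (copy-computes (value x)) λ { ≡.refl →
      𝔼-computes Goal (directAttn-computes q (K ∷ʳ key x) (V ∷ʳ value x)) λ o≈ → o≈ j } }
  filling-expectation {W = W} {m = m} s m<W K V (x ∷ xs) K≡ V≡ xs≡ (suc i) j
    rewrite ℕₚ.+-suc m (toℕ i) = trans
      (*-congʳ (trans (outputs-suc (filling m<W K V) x xs i j) stepped))
      (filled-expectation s m<W (K ∷ʳ key x) (V ∷ʳ value x) xs
        (prefixes-∷ʳ K (key ∘ s) K≡ (≡.cong key x≡))
        (prefixes-∷ʳ V (value ∘ s) V≡ (≡.cong value x≡))
        (prefixes-tail m s xs≡) i j)
    where
    x≡ : x ≡ s m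
    x≡ = prefixes-head m s xs≡
    rest : State _ W → ℝ
    rest s′ = 𝔼 (outputsFrom s′ xs) (coordinate i j)
    Goal : ℝ → Set _
    Goal e = e ≈ rest (filled m<W (K ∷ʳ key x) (V ∷ʳ value x))
    stepped : Goal (𝔼 (update x (filling m<W K V)) (λ r → rest (proj₂ r)))
    stepped =
      𝔼-computes Goal (copy-computes (key x)) λ { ≡.refl →
      𝔼-computes Goal (copy-computes (value x)) λ { ≡.refl →
      𝔼-computes Goal (directAttn-computes (query x) (K ∷ʳ key x) (V ∷ʳ value x)) λ _ → refl } }

  filled-expectation {m = m} s m<W K V xs K≡ V≡ xs≡ i j with ℕₚ.m≤n⇒m<n∨m≡n m<W
  ... | inj₁ m+1<W  = filling-expectation s m+1<W K V xs K≡ V≡ xs≡ i j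
  -- The window has just become full, and nothing has been evicted yet.
  ... | inj₂ ≡.refl = ≡.subst (λ n → IsAttention (suc m) s q j n μ) steps (begin
    μ * Σ< (N ℕ.+ suc m) (maskedWeight (suc m) q s (N ℕ.+ suc m))
      ≈⟨ *-congˡ (masked-total (suc m) N q s) ⟩
    μ * (fromℕ N + windowWeight (suc m) q s N)
      ≈⟨ sliding-expectation s 0 K V nothing xs K≡ V≡ xs≡ i j ⟩
    fromℕ 0 * outside nothing j + (Σ< N (valueAt j s) + windowValue (suc m) q s j N)
      ≈⟨ trans (+-congʳ (zeroˡ _)) (+-identityˡ _) ⟩
    Σ< N (valueAt j s) + windowValue (suc m) q s j N
      ≈⟨ masked-split (suc m) N q s (valueAt j s) ⟨
    Σ< (N ℕ.+ suc m) (λ l → maskedWeight (suc m) q s (N ℕ.+ suc m) l * valueAt j s l) ∎)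
    where
    q : Vec ℝ _
    q = query (lookup xs i)
    N : ℕ
    N = suc (toℕ i)
    μ : ℝ
    μ = 𝔼 (outputsFrom (sliding 0 K V nothing) xs) (coordinate i j)
    steps : N ℕ.+ suc m ≡ suc (suc m) ℕ.+ toℕ i
    steps = ≡.trans (ℕₚ.+-comm N (suc m)) (ℕₚ.+-suc (suc m) (toℕ i))

  unbiased : ∀ (d W n : ℕ) .{{_ : NonZero W}} (xs : Vec (Triple d) n) (i : Fin n) (j : Fin d) →
    𝔼 (outputs W xs) (coordinate i j) ≈ Attn W (qᵢ xs i) (Kᵢ xs i) (Vᵢ xs i) j
  unbiased d W n xs i j = *-cancelʳ-pos (proj₂ (sum⁺ w⁺)) (begin
    μ * sum w
      ≈⟨ *-congˡ (sum-cong-≋ w≈) ⟩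
    μ * Σ< N (maskedWeight W q s N)
      ≈⟨ filling-expectation s _ [] [] xs (λ ()) (λ ()) (prefixes-sequence _ xs) i j ⟩
    Σ< N (λ l → maskedWeight W q s N l * valueAt j s l)
      ≈⟨ sum-cong-≋ (λ l → *-cong (w≈ l) (reflexive (≡.cong (λ x → lookup (value x) j) (at l)))) ⟨
    sum (λ l → w l * Vᵢ xs i l j)
      ≈⟨ weighted-mean w⁺ (λ l → Vᵢ xs i l j) ⟨
    Attn W (qᵢ xs i) (Kᵢ xs i) (Vᵢ xs i) j * sum w ∎)
    where
    q : Vec ℝ d
    q = query (lookup xs i)
    N : ℕ
    N = suc (toℕ i)
    μ : ℝ
    μ = 𝔼 (outputs W xs) (coordinate i j)
    s : ℕ → Triple d
    -- Any triple would do as the default.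
    s = sequence (lookup xs i) xs
    w⁺ : Fin N → ℝ⁺
    w⁺ l = exp⁺ (sum (λ j′ → Kᵢ xs i l j′ * qᵢ xs i j′) * mask W l)
    w : Fin N → ℝ
    w l = proj₁ (w⁺ l)
    at : ∀ l → lookup xs (inject≤ l (toℕ<n i)) ≡ s (toℕ l)
    at l = ≡.trans (prefixes-sequence (lookup xs i) xs _) (≡.cong s (toℕ-inject≤ l _))
    w≈ : ∀ l → w l ≈ maskedWeight W q s N (toℕ l)
    w≈ l = reflexive (≡.cong (λ x → exp (score q (key x) * mask W l)) (at l))

-- Time and space

module Cost {c ℓ₁ ℓ₂} (R : RealNumbers c ℓ₁ ℓ₂) where
  open RealNumbers R using (ℝ; 0#)
  open SlidingWindow R
  open Triple
  open ℕₚ.≤-Reasoning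

  private variable
    a e : Level
    A : Set a
    B : Set e
    C : Set e
    d m W : ℕ

  maximum-upper : (f : Fin m → ℕ) (l : Fin m) → f l ℕ.≤ maximum f
  maximum-upper f zero    = ℕₚ.m≤m⊔n (f zero) _
  maximum-upper f (suc l) = ℕₚ.≤-trans (maximum-upper (f ∘ suc) l) (ℕₚ.m≤n⊔m (f zero) _)

  maximum-least : (f : Fin m → ℕ) {b : ℕ} → (∀ l → f l ℕ.≤ b) → maximum f ℕ.≤ b
  maximum-least {zero}  f f≤b = ℕ.z≤n
  maximum-least {suc m} f f≤b = ℕₚ.⊔-lub (f≤b zero) (maximum-least (f ∘ suc) (f≤b ∘ suc))

  maximum-mono : {f g : Fin m → ℕ} → (∀ l → f l ℕ.≤ g l) → maximum f ℕ.≤ maximum g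
  maximum-mono f≤g = maximum-least _ λ l → ℕₚ.≤-trans (f≤g l) (maximum-upper _ l)

  -- Writing a number costs a step, so bounds on time are bounds on space.
  written≤time : (p : Prog A) → written p ℕ.≤ time p
  written≤time (return x)       = ℕ.z≤n
  written≤time (step p)         = ℕ.s≤s (written≤time p)
  written≤time (flip _ k)       =
    ℕₚ.m≤n⇒m≤1+n (ℕₚ.⊔-mono-≤ (written≤time (k true)) (written≤time (k false)))
  written≤time (sample {m} _ k) =
    ℕₚ.m≤n⇒m≤o+n (suc m) (maximum-mono λ l → written≤time (k l))

  time->>= : (p : Prog A) {k : A → Prog B} {b : ℕ} →
             (∀ x → time (k x) ℕ.≤ b) → time (p >>= k) ℕ.≤ time p ℕ.+ b
  time->>= (return x)    k≤b = k≤b x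
  time->>= (step p)      k≤b = ℕ.s≤s (time->>= p k≤b)
  time->>= (flip _ k′) {b = b} k≤b = ℕ.s≤s (ℕₚ.⊔-lub
    (ℕₚ.≤-trans (time->>= (k′ true) k≤b) (ℕₚ.+-monoˡ-≤ b (ℕₚ.m≤m⊔n _ _)))
    (ℕₚ.≤-trans (time->>= (k′ false) k≤b) (ℕₚ.+-monoˡ-≤ b (ℕₚ.m≤n⊔m (time (k′ true)) _))))
  time->>= (sample {m} ws k′) {k} {b} k≤b = begin
    suc m ℕ.+ maximum (λ l → time (k′ l >>= k))
      ≤⟨ ℕₚ.+-monoʳ-≤ (suc m) (maximum-least _ λ l →
           ℕₚ.≤-trans (time->>= (k′ l) {k} k≤b)
                         (ℕₚ.+-monoˡ-≤ b (maximum-upper (λ l → time (k′ l)) l))) ⟩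
    suc m ℕ.+ (maximum (λ l → time (k′ l)) ℕ.+ b)
      ≡⟨ ℕₚ.+-assoc (suc m) _ b ⟨
    (suc m ℕ.+ maximum (λ l → time (k′ l))) ℕ.+ b ∎

  time-then : (p : Prog A) {k : A → Prog B} {a b : ℕ} → time p ℕ.≤ a →
              (∀ x → time (k x) ℕ.≤ b) → time (p >>= k) ℕ.≤ a ℕ.+ b
  time-then p {b = b} p≤a k≤b = ℕₚ.≤-trans (time->>= p k≤b) (ℕₚ.+-monoˡ-≤ b p≤a)

  time-mapM : {f : A → Prog B} {b : ℕ} → (∀ x → time (f x) ℕ.≤ b) →
              (xs : Vec A m) → time (mapM f xs) ℕ.≤ m ℕ.* b
  time-mapM f≤b []       = ℕ.z≤n
  time-mapM {f = f} {b} f≤b (_∷_ {n} x xs) = time-then (f x) (f≤b x) λ y →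
    ℕₚ.≤-trans (time-then (mapM f xs) (time-mapM f≤b xs) λ _ → ℕ.z≤n)
               (ℕₚ.≤-reflexive (ℕₚ.+-identityʳ (n ℕ.* b)))

  time-mapM-op : (f : A → B) (xs : Vec A m) → time (mapM (λ x → op (f x)) xs) ℕ.≤ m
  time-mapM-op {m = m} f xs = ℕₚ.≤-trans (time-mapM (λ _ → ℕₚ.≤-refl) xs)
                                         (ℕₚ.≤-reflexive (ℕₚ.*-identityʳ m))

  time-zipWithM-op : (f : A → B → C) (xs : Vec A m) (ys : Vec B m) →
                     time (zipWithM (λ x y → op (f x y)) xs ys) ℕ.≤ m
  time-zipWithM-op f []       []       = ℕ.z≤n
  time-zipWithM-op {m = suc m} f (x ∷ xs) (y ∷ ys) = ℕ.s≤s (ℕₚ.≤-trans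
    (time-then (zipWithM _ xs ys) (time-zipWithM-op f xs ys) λ _ → ℕ.z≤n)
    (ℕₚ.≤-reflexive (ℕₚ.+-identityʳ m)))

  time-dot : (xs ys : Vec ℝ d) → time (dot xs ys) ℕ.≤ d ℕ.* 2 ℕ.+ 1
  time-dot []       []       = ℕₚ.≤-refl
  time-dot {d = suc d} (x ∷ xs) (y ∷ ys) = ℕ.s≤s (begin
    time (dot xs ys >>= λ r → op _)  ≤⟨ time-then (dot xs ys) (time-dot xs ys) (λ _ → ℕₚ.≤-refl) ⟩
    (d ℕ.* 2 ℕ.+ 1) ℕ.+ 1            ≡⟨ ℕₚ.+-comm _ 1 ⟩
    suc (d ℕ.* 2 ℕ.+ 1)              ∎)

  time-total : (ws : Vec ℝ⁺ (suc m)) → time (total ws) ℕ.≤ suc m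
  time-total (x ∷ [])                 = ℕₚ.≤-refl
  time-total {suc m} (x ∷ y ∷ ws) = ℕₚ.≤-trans
    (time-then (total (y ∷ ws)) (time-total (y ∷ ws)) (λ _ → ℕₚ.≤-refl))
    (ℕₚ.≤-reflexive (ℕₚ.+-comm (suc m) 1))

  time-weights : (q : Vec ℝ d) (K : Vec (Vec ℝ d) m) →
                 time (weights q K) ℕ.≤ m ℕ.* ((d ℕ.* 2 ℕ.+ 1) ℕ.+ 1)
  time-weights q = time-mapM λ k → time-then (dot k q) (time-dot k q) (λ _ → ℕₚ.≤-refl)

  time-combine : (ws : Vec ℝ⁺ m) (V : Vec (Vec ℝ d) m) →
                 time (combine ws V) ℕ.≤ m ℕ.* (d ℕ.+ d) ℕ.+ d
  time-combine []       []      = time-mapM-op _ (replicate _ 0#)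
  time-combine {d = d} (_∷_ {n = m} w ws) (v ∷ V) = begin
    time (combine (w ∷ ws) (v ∷ V))
      ≤⟨ time-then (mapM _ v) (time-mapM-op _ v) (λ u →
         time-then (combine ws V) (time-combine ws V) (λ r → time-zipWithM-op _ u r)) ⟩
    d ℕ.+ ((m ℕ.* (d ℕ.+ d) ℕ.+ d) ℕ.+ d)
      ≡⟨ ≡.cong (d ℕ.+_) (ℕₚ.+-comm _ d) ⟩
    d ℕ.+ (d ℕ.+ (m ℕ.* (d ℕ.+ d) ℕ.+ d))
      ≡⟨ ℕₚ.+-assoc d d _ ⟨
    (d ℕ.+ d) ℕ.+ (m ℕ.* (d ℕ.+ d) ℕ.+ d)
      ≡⟨ ℕₚ.+-assoc (d ℕ.+ d) _ d ⟨
    ((d ℕ.+ d) ℕ.+ m ℕ.* (d ℕ.+ d)) ℕ.+ d ∎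

  -- p takes time at most a * u.  A record, unlike the inequality itself, lets a be
  -- inferred by unification, so that the constants of a program add up by
  -- themselves.
  record Within (u a : ℕ) {A : Set e} (p : Prog A) : Set where
    constructor within
    field bound : time p ℕ.≤ a ℕ.* u

  open Within

  within-then : {u a b : ℕ} {p : Prog A} {k : A → Prog B} →
    Within u a p → (∀ x → Within u b (k x)) → Within u (a ℕ.+ b) (p >>= k)
  within-then {u = u} {a} {b} {p} (within p≤) k≤ = within (ℕₚ.≤-trans
    (time-then p p≤ (λ x → bound (k≤ x)))
    (ℕₚ.≤-reflexive (≡.sym (ℕₚ.*-distribʳ-+ u a b))))

  within-return : {u : ℕ} {x : A} → Within u 0 (return x)
  within-return = within ℕ.z≤n

  thrice : ∀ n → (n ℕ.+ n) ℕ.+ n ≡ 3 ℕ.* n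
  thrice n = ≡.trans (ℕₚ.+-assoc n n n)
    (≡.cong (λ k → n ℕ.+ (n ℕ.+ k)) (≡.sym (ℕₚ.+-identityʳ n)))

  module _ {d W : ℕ} .{{_ : NonZero d}} .{{_ : NonZero W}} where
    -- The common unit of all bounds.
    u : ℕ
    u = d ℕ.* W

    1≤u : 1 ℕ.≤ u
    1≤u = ℕₚ.*-mono-≤ (ℕ.>-nonZero⁻¹ d) (ℕ.>-nonZero⁻¹ W)

    d≤u : d ℕ.≤ u
    d≤u = ℕₚ.m≤m*n d W

    W≤u : W ℕ.≤ u
    W≤u = ℕₚ.m≤n*m W d

    within-unit : {p : Prog A} → time p ℕ.≤ u → Within u 1 p
    within-unit p≤u = within (ℕₚ.≤-trans p≤u (ℕₚ.≤-reflexive (≡.sym (ℕₚ.*-identityˡ u))))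

    within-step : {a : ℕ} {p : Prog A} → Within u a p → Within u (suc a) (step p)
    within-step (within p≤) = within (ℕₚ.+-mono-≤ 1≤u p≤)

    within-flip : {a : ℕ} {r : ℝ} {k : Bool → Prog A} →
                  (∀ b → Within u a (k b)) → Within u (suc a) (flip r k)
    within-flip k≤ = within (ℕₚ.+-mono-≤ 1≤u (ℕₚ.⊔-lub (bound (k≤ true)) (bound (k≤ false))))

    within-copy : (v : Vec ℝ d) → Within u 1 (copy v)
    within-copy v = within-unit (ℕₚ.≤-trans (time-mapM-op _ v) d≤u)

    within-weights : m ℕ.≤ W → (q : Vec ℝ d) (K : Vec (Vec ℝ d) m) →
                     Within u 4 (weights q K)
    within-weights {m = m} m≤W q K = within (begin
      time (weights q K)                  ≤⟨ time-weights q K ⟩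
      m ℕ.* ((d ℕ.* 2 ℕ.+ 1) ℕ.+ 1)       ≡⟨ ≡.cong (m ℕ.*_) (ℕₚ.+-assoc (d ℕ.* 2) 1 1) ⟩
      m ℕ.* (d ℕ.* 2 ℕ.+ 1 ℕ.* 2)         ≤⟨ ℕₚ.*-mono-≤ m≤W (ℕₚ.+-monoʳ-≤ (d ℕ.* 2)
                                               (ℕₚ.*-monoˡ-≤ 2 (ℕ.>-nonZero⁻¹ d))) ⟩
      W ℕ.* (d ℕ.* 2 ℕ.+ d ℕ.* 2)         ≡⟨ ≡.cong (W ℕ.*_) (ℕₚ.*-distribˡ-+ d 2 2) ⟨
      W ℕ.* (d ℕ.* 4)                     ≡⟨ ℕₚ.*-assoc W d 4 ⟨
      (W ℕ.* d) ℕ.* 4                     ≡⟨ ℕₚ.*-comm (W ℕ.* d) 4 ⟩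
      4 ℕ.* (W ℕ.* d)                     ≡⟨ ≡.cong (4 ℕ.*_) (ℕₚ.*-comm W d) ⟩
      4 ℕ.* u                             ∎)

    within-total : suc m ℕ.≤ W → (ws : Vec ℝ⁺ (suc m)) → Within u 1 (total ws)
    within-total m<W ws = within-unit (ℕₚ.≤-trans (time-total ws) (ℕₚ.≤-trans m<W W≤u))

    within-combine : m ℕ.≤ W → (ws : Vec ℝ⁺ m) (V : Vec (Vec ℝ d) m) →
                     Within u 3 (combine ws V)
    within-combine {m = m} m≤W ws V = within (begin
      time (combine ws V)          ≤⟨ time-combine ws V ⟩
      m ℕ.* (d ℕ.+ d) ℕ.+ d        ≤⟨ ℕₚ.+-mono-≤ (ℕₚ.*-monoˡ-≤ (d ℕ.+ d) m≤W) d≤u ⟩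
      W ℕ.* (d ℕ.+ d) ℕ.+ u        ≡⟨ ≡.cong (ℕ._+ u) (ℕₚ.*-distribˡ-+ W d d) ⟩
      (W ℕ.* d ℕ.+ W ℕ.* d) ℕ.+ u  ≡⟨ ≡.cong (λ w → (w ℕ.+ w) ℕ.+ u) (ℕₚ.*-comm W d) ⟩
      (u ℕ.+ u) ℕ.+ u              ≡⟨ thrice u ⟩
      3 ℕ.* u                      ∎)

    within-directAttn : suc m ℕ.≤ W → (q : Vec ℝ d) (K V : Vec (Vec ℝ d) (suc m)) →
                        Within u 9 (directAttn q K V)
    within-directAttn m<W q K V =
      within-then (within-weights m<W q K) λ ws →
      within-then (within-total m<W ws) λ Z →
      within-then (within-combine m<W ws V) λ r →
      within-unit (ℕₚ.≤-trans (time-mapM-op _ r) d≤u)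

    within-choose : suc m ℕ.≤ W → (ws : Vec ℝ⁺ (suc m)) → Within u 1 (choose ws)
    within-choose {m = m} m<W ws = within-unit (ℕₚ.≤-trans
      (ℕₚ.+-monoʳ-≤ (suc m) (maximum-least {suc m} (λ _ → 0) λ _ → ℕₚ.≤-refl))
      (ℕₚ.≤-trans (ℕₚ.≤-reflexive (ℕₚ.+-identityʳ (suc m))) (ℕₚ.≤-trans m<W W≤u)))

  within-update : .{{_ : NonZero d}} .{{_ : NonZero W}} (x : Triple d) (s : State d W) →
                  Within (d ℕ.* W) 17 (update x s)
  within-update (triple q k v) (filling m<W K V) =
    within-then (within-copy k) λ k′ →
    within-then (within-copy v) λ v′ →
    within-then (within-directAttn m<W q (K ∷ʳ k′) (V ∷ʳ v′)) λ o →
    within ℕ.z≤n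
  within-update {d = d} {W = suc m} (triple q k v) (sliding t (_ ∷ K) (v₁ ∷ V) vₛ) =
    within-then (within-copy v₁) λ old →
    within-then (within-copy k) λ k′ →
    within-then (within-copy v) λ v′ →
    within-step {d} {suc m} (
    within-step {d} {suc m} (
    within-flip {d} {suc m} λ replace →
    within-then (within-weights ℕₚ.≤-refl q (K ∷ʳ k′)) λ ws →
    within-then (within-total {d} ℕₚ.≤-refl ws) λ E →
    within-step {d} {suc m} (
    within-step {d} {suc m} (
    within-step {d} {suc m} (
    within-flip {d} {suc m} λ inside →
    within-then (within-output ws (V ∷ʳ v′)
      (fromMaybe (replicate d 0#) (if replace then just old else vₛ)) inside) λ o →
    within-return)))))
    where
    within-output : (ws : Vec ℝ⁺ (suc m)) (V′ : Vec (Vec ℝ d) (suc m))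
      (w : Vec ℝ d) (inside : Bool) → Within (d ℕ.* suc m) 2
        (if inside then (choose ws >>= λ l → copy (lookup V′ l)) else copy w)
    within-output ws V′ w true  =
      within-then (within-choose ℕₚ.≤-refl ws) λ l → within-copy (lookup V′ l)
    within-output ws V′ w false =
      within (ℕₚ.≤-trans (bound (within-copy w)) (ℕₚ.*-monoˡ-≤ _ {1} {2} (ℕ.s≤s ℕ.z≤n)))

  stored-bound : .{{_ : NonZero d}} .{{_ : NonZero W}} (s : State d W) →
                 stored s ℕ.≤ 3 ℕ.* (d ℕ.* W)
  stored-bound {d} {W} s = ℕₚ.≤-trans (bounded s) (ℕₚ.≤-reflexive regroup)
    where
    regroup : (W ℕ.* d ℕ.+ W ℕ.* d) ℕ.+ W ℕ.* d ≡ 3 ℕ.* (d ℕ.* W)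
    regroup = ≡.trans (thrice (W ℕ.* d)) (≡.cong (3 ℕ.*_) (ℕₚ.*-comm W d))
    bounded : (s : State d W) → stored s ℕ.≤ (W ℕ.* d ℕ.+ W ℕ.* d) ℕ.+ W ℕ.* d
    bounded (filling {m} m<W _ _) = ℕₚ.≤-trans
      (ℕₚ.+-mono-≤ (ℕₚ.*-monoˡ-≤ d (ℕₚ.<⇒≤ m<W)) (ℕₚ.*-monoˡ-≤ d (ℕₚ.<⇒≤ m<W)))
      (ℕₚ.m≤m+n _ _)
    bounded (sliding t _ _ nothing)  = ℕₚ.+-monoʳ-≤ (W ℕ.* d ℕ.+ W ℕ.* d) ℕ.z≤n
    bounded (sliding t _ _ (just _)) = ℕₚ.+-monoʳ-≤ (W ℕ.* d ℕ.+ W ℕ.* d) (ℕₚ.m≤n*m d W)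

  -- Stored numbers, the received triple and the numbers written account for 3, 3
  -- and 17 times d * W.
  update-cost : .{{_ : NonZero d}} .{{_ : NonZero W}} (x : Triple d) (s : State d W) →
    updateSpace x s ℕ.≤ 23 ℕ.* (d ℕ.* W) × updateTime x s ℕ.≤ 23 ℕ.* (d ℕ.* W)
  update-cost {d} {W} x s =
    (begin
      stored s ℕ.+ 3 ℕ.* d ℕ.+ written (update x s)
        ≤⟨ ℕₚ.+-mono-≤ (ℕₚ.+-mono-≤ (stored-bound s) (ℕₚ.*-monoʳ-≤ 3 (ℕₚ.m≤m*n d W)))
                       (ℕₚ.≤-trans (written≤time (update x s)) time≤) ⟩
      3 ℕ.* n ℕ.+ 3 ℕ.* n ℕ.+ 17 ℕ.* n
        ≡⟨ ≡.cong (ℕ._+ 17 ℕ.* n) (ℕₚ.*-distribʳ-+ n 3 3) ⟨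
      6 ℕ.* n ℕ.+ 17 ℕ.* n
        ≡⟨ ℕₚ.*-distribʳ-+ n 6 17 ⟨
      23 ℕ.* n ∎) ,
    ℕₚ.≤-trans time≤ (ℕₚ.*-monoˡ-≤ n {17} {23} (ℕₚ.m≤m+n 17 6))
    where
    n : ℕ
    n = d ℕ.* W
    time≤ : time (update x s) ℕ.≤ 17 ℕ.* n
    time≤ = bound (within-update x s)

open import Data.Nat.Base using (_*_; _≤_)

theorem24 : ∀ {c ℓ₁ ℓ₂} (R : RealNumbers c ℓ₁ ℓ₂) →
  let open RealNumbers R using (_≈_)
      open SlidingWindow R in
  (∀ (d W n : ℕ) .{{_ : NonZero d}} .{{_ : NonZero W}}
     (xs : Vec (Triple d) n) (i : Fin n) (j : Fin d) →
     𝔼 (outputs W xs) (λ O → lookup (lookup O i) j)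
       ≈ Attn W (qᵢ xs i) (Kᵢ xs i) (Vᵢ xs i) j)
  ×
  (∃ λ (C : ℕ) → ∀ (d W n : ℕ) .{{_ : NonZero d}} .{{_ : NonZero W}}
     (xs : Vec (Triple d) n) (i : Fin n) →
     Always (λ s → updateSpace (lookup xs i) s ≤ C * (d * W)
                 × updateTime (lookup xs i) s ≤ C * (d * W))
            (stateBefore W xs i))
theorem24 R =
  (λ d W n xs i j → Expectation.unbiased R d W n xs i j) ,
  23 , λ d W n xs i →
    Programs.always R (Cost.update-cost R (lookup xs i)) (SlidingWindow.stateBefore R W xs i)
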